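{- Let $I=\{1,\dots,n\}$ be a finite set of agents, and let $X$ be a measurable space of states whose $\sigma$-algebra $\Sigma_X$ is generated by the singletons $\{x\}$, $x\in X$. Consider the language $\mathcal{L}_B^{[0,1]}(X,I)$ (primitive propositions $\Phi=X$, thresholds $\Theta=[0,1]$), and let $\mathscr{C}_X$ be the class of probability models $\mathcal{M}=((\Omega,(\mathit{Pr}_i)_{i\in I}),\pi)$ over $(X,I)$ such that $\{\pi(x) : x\in X\}$ partitions $\Omega$. Let $\bar{\mathcal{M}}$ be the universal probability model for $\mathscr{C}_X$ over $\mathcal{L}_B^{[0,1]}(X,I)$. Then the type space $\mathcal{T}_{\bar{\mathcal{M}}}$ (its state space $\{d_0(\bar\omega) : \bar\omega\in\bar\Omega\}$ being identified with $X$ by matching $d_0(\bar\omega)$ with the unique element of $X$ it contains) is universal for $X$; that is, for every type space $\mathcal{T}=(X,(T_i)_{i\in I},(\beta_i)_{i\in I})$ with state space $X$ there exists a unique type morphism from $\mathcal{T}$ to $\mathcal{T}_{\bar{\mathcal{M}}}$.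
   Context: **Measure theory.** A measurable space is a set $Y$ with a $\sigma$-algebra $\Sigma_Y$, whose elements are called events. $\Delta(Y)$ is the set of probability measures on $Y$ with the $\sigma$-algebra generated by the sets $\mathcal{B}^\theta(E)=\{\mu\in\Delta(Y):\mu(E)\ge\theta\}$, $\theta\in[0,1]$, $E\in\Sigma_Y$. Finite products carry the product $\sigma$-algebra. For $\mu\in\Delta(Y)$ and $A\subseteq Y$, $\mu^*(A)=\inf\{\mu(E):E\in\Sigma_Y,\ E\supseteq A\}$. Write $T=\prod_{i\in I}T_i$. **Type spaces.** A type space (over $I$) is $\mathcal{T}=(X,(T_i)_{i\in I},(\beta_i)_{i\in I})$ where $X$ and each $T_i$ are measurable spaces and each $\beta_i:T_i\to\Delta(X\times T)$ is a measurable function such that the marginal of $\beta_i(t_i)$ on $T_i$ is $\delta_{t_i}$ (for events $E\subseteq T_i$, $\delta_{t_i}(E)=1$ if $t_i\in E$ and $0$ otherwise). Given type spaces $\mathcal{T}=(X,(T_i),(\beta_i))$ and $\mathcal{T}'=(X,(T'_i),(\beta'_i))$ with the same state space, a profile of functions $f_i:T_i\to T_i'$ ($i\in I$) is a type morphism from $\mathcal{T}$ to $\mathcal{T}'$ if for each $i\in I$, $t_i\in T_i$ and each event $E\subseteq X\times T'$, $\beta_i'(f_i(t_i))(E)=\beta_i(t_i)(f^{ -1}(E))$, where $f=(\mathrm{id}_X,f_1,\dots,f_n):X\times T\to X\times T'$ (this includes the requirement that $f^{ -1}(E)$ is an event, so that the right-hand side is defined). A type space $\mathcal{T}^*$ with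 state space $X$ is universal for $X$ if for every type space $\mathcal{T}$ with state space $X$ there is a unique type morphism from $\mathcal{T}$ to $\mathcal{T}^*$. **Language and probability models.** For a set $\Phi$ of primitive propositions and $\Theta\subseteq[0,1]$, $\mathcal{L}_B^\Theta(\Phi,I)$ is the language generated by $\phi::=p\mid\lnot\phi\mid\phi\land\psi\mid B_i^\theta\phi$ with $p\in\Phi$, $i\in I$, $\theta\in\Theta$. A probability frame (over $I$) is $(\Omega,(\mathit{Pr}_i)_{i\in I})$ where $\Omega$ is a measurable space and each $\mathit{Pr}_i:\Omega\to\Delta(\Omega)$ is measurable with $\mathit{Pr}_i(\omega)^*(\mathit{Pr}_i^{ -1}(\mathit{Pr}_i(\omega)))=1$ for all $\omega$. A probability model over $(\Phi,I)$ is $\mathcal{M}=((\Omega,(\mathit{Pr}_i)),\pi)$, a probability frame with a map $\pi:\Phi\to\Sigma_\Omega$. Truth sets are defined by $[\![p]\!]_{\mathcal M}=\pi(p)$, $[\![\lnot\phi]\!]_{\mathcal M}=\Omega\setminus[\![\phi]\!]_{\mathcal M}$, $[\![\phi\land\psi]\!]_{\mathcal M}=[\![\phi]\!]_{\mathcal M}\cap[\![\psi]\!]_{\mathcal M}$, $[\![B_i^\theta\phi]\!]_{\mathcal M}=\{\omega:\mathit{Pr}_i(\omega)([\![\phi]\!]_{\mathcal M})\ge\theta\}$. A set of formulas is satisfiable (in $\mathcal{M}$) if all its members are true at one common world of some probability model (of $\mathcal M$). A description is a satisfiable set $D$ of formulas such that for each formula $\phi$, $\phi\in D$ or $\lnot\phi\in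 D$. **Universal probability model.** For a class $\mathscr{C}$ of probability models over $(\Phi,I)$, the universal probability model for $\mathscr{C}$ over $\mathcal{L}_B^{[0,1]}(\Phi,I)$ is $\bar{\mathcal M}=((\bar\Omega,(\overline{\mathit{Pr}}_i)_{i\in I}),\bar\pi)$, where $\bar\Omega$ is the set of all $\mathcal{L}_B^{[0,1]}(\Phi,I)$-descriptions satisfiable in some model in $\mathscr{C}$; $\hat\phi=\{\bar\omega\in\bar\Omega:\phi\in\bar\omega\}$; $\Sigma_{\bar\Omega}$ is generated by the algebra $\{\hat\phi:\phi\in\mathcal{L}_B^{[0,1]}(\Phi,I)\}$; $\overline{\mathit{Pr}}_i(\bar\omega)$ is the unique probability measure on $\Sigma_{\bar\Omega}$ with $\overline{\mathit{Pr}}_i(\bar\omega)(\hat\phi)=\sup\{\theta\in[0,1]:B_i^\theta\phi\in\bar\omega\}$ for all $\phi$; and $\bar\pi(p)=\hat p$. **The type space $\mathcal{T}_{\mathcal M}$ of a probability model $\mathcal M$** (with respect to $\mathcal L=\mathcal{L}_B^\Theta(\Phi,I)$, $\Theta$ dense in $[0,1]$; here $\Theta=[0,1]$). For a world $\omega$ let $D(\omega)=\{\phi\in\mathcal L:\omega\in[\![\phi]\!]_{\mathcal M}\}$; let $d_0(\omega)\subseteq D(\omega)$ be its purely propositional formulas (Boolean combinations of primitive propositions), and $d_i(\omega)\subseteq D(\omega)$ its formulas that are Boolean combinations of formulas of the form $B_i^\theta\phi$. The state space is $S=\{d_0(\omega):\omega\in\Omega\}$ with the $\sigma$-algebra generated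 by the sets $E_0(\phi)=\{x\in S:\phi\in x\}$, $\phi\in\mathcal L$; the $i$-type space is $T_i=\{d_i(\omega):\omega\in\Omega\}$ with the $\sigma$-algebra generated by $E_i(\phi)=\{t_i\in T_i:\phi\in t_i\}$, $\phi\in\mathcal L$. For $(x,t)\in S\times T$ there is a unique description $D(x,t)\supseteq x\cup\bigcup_i t_i$; put $[\phi]=\{(x,t)\in S\times T:\phi\in D(x,t)\}$. Then $\beta_i(t_i)$ is the unique probability measure $\mu$ on $S\times T$ such that for all $\phi\in\mathcal L$ and $\theta\in\Theta$: $\mu([\phi])\ge\theta\iff B_i^\theta\phi\in t_i$. Set $\mathcal{T}_{\mathcal M}=(S,(T_i)_{i\in I},(\beta_i)_{i\in I})$. -}

module Defs where

open import Axiom.ExcludedMiddle using (ExcludedMiddle)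
open import Data.Empty using (⊥)
open import Data.Fin.Base using (Fin)
open import Data.Nat.Base using (ℕ; zero; suc)
open import Data.Product using (Σ; Σ-syntax; ∃; ∃₂; ∃!; _×_; _,_; proj₁; proj₂)
open import Data.Rational as ℚ using (ℚ; 0ℚ; 1ℚ)
import Data.Rational.Properties as ℚₚ
open import Data.Sum.Base using (_⊎_; inj₁; inj₂)
open import Data.Unit.Base using (⊤; tt)
open import Function.Base using (_∘_)
open import Function.Bundles using (Func; _⇔_)
open import Level using (Level; 0ℓ; _⊔_; Lift; lower) renaming (suc to lsuc)
open import Relation.Binary.Bundles using (Setoid)
open import Relation.Binary.Definitions using (_Respects_; tri<; tri≈; tri>)
open import Relation.Binary.PropositionalEquality using (_≡_; _≢_; refl; subst)
open import Relation.Nullary using (contradiction)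
open import Relation.Nullary.Decidable using (True; toWitness; decidable-stable)
open import Relation.Unary renaming (_⊥_ to _DisjointFrom_)

------------------------------------------------------------------------
-- Real numbers as lower Dedekind cuts.  This is the classical real line
-- only in the presence of excluded middle, which is assumed below.

record ℝ : Set₁ where
  field
    Lower     : Pred ℚ 0ℓ
    inhabited : ∃ Lower
    bounded   : ∃ λ q → q ∉ Lower
    downward  : ∀ {p q} → p ℚ.< q → q ∈ Lower → p ∈ Lower
    rounded   : ∀ {p} → p ∈ Lower → ∃ λ q → p ℚ.< q × q ∈ Lower

open ℝ

infix 4 _≤_ _≃_
infixl 6 _+_

_≤_ : ℝ → ℝ → Set
x ≤ y = Lower x ⊆ Lower y

_≃_ : ℝ → ℝ → Set
x ≃ y = Lower x ≐ Lower y

private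
  q<q+1 : ∀ q → q ℚ.< q ℚ.+ 1ℚ
  q<q+1 q = subst (ℚ._< q ℚ.+ 1ℚ) (ℚₚ.+-identityʳ q)
                  (ℚₚ.+-mono-≤-< (ℚₚ.≤-refl {q}) (ℚₚ.positive⁻¹ 1ℚ))

  q-1<q : ∀ q → q ℚ.+ ℚ.- 1ℚ ℚ.< q
  q-1<q q = subst (q ℚ.+ ℚ.- 1ℚ ℚ.<_) (ℚₚ.+-identityʳ q)
                  (ℚₚ.+-mono-≤-< (ℚₚ.≤-refl {q}) (ℚₚ.negative⁻¹ (ℚ.- 1ℚ)))

  below-bound : ∀ x {p q} → p ∈ Lower x → q ∉ Lower x → p ℚ.< q
  below-bound x {p} {q} p∈x q∉x with ℚₚ.<-cmp p q
  ... | tri< p<q _ _  = p<q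
  ... | tri≈ _ refl _ = contradiction p∈x q∉x
  ... | tri> _ _ q<p  = contradiction (downward x q<p p∈x) q∉x

fromℚ : ℚ → ℝ
fromℚ q = record
  { Lower     = ℚ._< q
  ; inhabited = _ , q-1<q q
  ; bounded   = q , ℚₚ.<-irrefl refl
  ; downward  = ℚₚ.<-trans
  ; rounded   = λ p<q → let m , p<m , m<q = ℚₚ.<-dense p<q in m , p<m , m<q
  }

0ℝ 1ℝ : ℝ
0ℝ = fromℚ 0ℚ
1ℝ = fromℚ 1ℚ

_+_ : ℝ → ℝ → ℝ
x + y = record
  { Lower     = λ q → ∃₂ λ r s → r ∈ Lower x × s ∈ Lower y × q ℚ.< r ℚ.+ s
  ; inhabited = let r , r∈x = inhabited x
                    s , s∈y = inhabited y
                in _ , r , s , r∈x , s∈y , q-1<q (r ℚ.+ s)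
  ; bounded   = let a , a∉x = bounded x
                    b , b∉y = bounded y
                in a ℚ.+ b , λ (r , s , r∈x , s∈y , a+b<r+s) →
                     ℚₚ.<-asym a+b<r+s
                       (ℚₚ.+-mono-< (below-bound x r∈x a∉x)
                                    (below-bound y s∈y b∉y))
  ; downward  = λ p<q (r , s , r∈x , s∈y , q<r+s) →
                  r , s , r∈x , s∈y , ℚₚ.<-trans p<q q<r+s
  ; rounded   = λ (r , s , r∈x , s∈y , p<r+s) →
                  let m , p<m , m<r+s = ℚₚ.<-dense p<r+s
                  in m , p<m , r , s , r∈x , s∈y , m<r+s
  }

partialSum : (ℕ → ℝ) → ℕ → ℝ
partialSum f zero    = 0ℝ
partialSum f (suc N) = partialSum f N + f N

IsSup : ∀ {p} → Pred ℝ p → Pred ℝ (lsuc 0ℓ ⊔ p)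
IsSup P x = (∀ y → P y → y ≤ x) × (∀ z → (∀ y → P y → y ≤ z) → x ≤ z)

IsInf : ∀ {p} → Pred ℝ p → Pred ℝ (lsuc 0ℓ ⊔ p)
IsInf P x = (∀ y → P y → x ≤ y) × (∀ z → (∀ y → P y → z ≤ y) → z ≤ x)

𝕀 : Set₁
𝕀 = Σ[ θ ∈ ℝ ] (0ℝ ≤ θ × θ ≤ 1ℝ)

-- "a is the unique element satisfying P", up to ≈.
IsTheUnique : ∀ {a e p} {A : Set a} → (A → A → Set e) → Pred A p → Pred A (a ⊔ e ⊔ p)
IsTheUnique _≈_ P a = P a × (∀ {b} → P b → a ≈ b)

-- The smallest σ-algebra containing G.  Closure under ≐ replaces the
-- extensionality of sets.
data σ {a g} {Y : Set a} (G : Pred (Pred Y 0ℓ) g) : Pred (Pred Y 0ℓ) (lsuc 0ℓ ⊔ a ⊔ g) where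
  gen   : ∀ {E} → G E → σ G E
  whole : σ G (λ _ → ⊤)
  compl : ∀ {E} → σ G E → σ G (∁ E)
  union : ∀ {E : ℕ → Pred Y 0ℓ} → (∀ k → σ G (E k)) → σ G (⋃ ℕ E)
  ext   : ∀ {E F} → E ≐ F → σ G E → σ G F

------------------------------------------------------------------------
-- A "set" is a setoid with carrier in Set (lsuc ℓ), and a subset is a
-- Set₀-valued predicate: by excluded middle every proposition, of
-- whatever level, is equivalent to one in Set₀, so no subset is lost.
-- The level lsuc ℓ is closed under the formation of sets of formulas.

module Theory (em : ∀ {a} → ExcludedMiddle a) (ℓ : Level) (n : ℕ) where

  record MeasurableSpace : Set (lsuc (lsuc ℓ)) where
    field
      setoid  : Setoid (lsuc ℓ) (lsuc ℓ)

    open Setoid setoid public using (Carrier; _≈_)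

    field
      IsEvent       : Pred (Pred Carrier 0ℓ) (lsuc ℓ)
      whole-event   : IsEvent (λ _ → ⊤)
      compl-event   : ∀ {E} → IsEvent E → IsEvent (∁ E)
      union-event   : ∀ {E : ℕ → Pred Carrier 0ℓ} → (∀ k → IsEvent (E k)) → IsEvent (⋃ ℕ E)
      ext-event     : ∀ {E F} → E ≐ F → IsEvent E → IsEvent F
      event-respects : ∀ {E} → IsEvent E → E Respects _≈_

    Event : Set (lsuc ℓ)
    Event = ∃ IsEvent

  open MeasurableSpace using (Carrier; setoid; IsEvent; Event)

  generate : (S : Setoid (lsuc ℓ) (lsuc ℓ)) (G : Pred (Pred (Setoid.Carrier S) 0ℓ) (lsuc ℓ)) →
             (∀ {E} → G E → E Respects Setoid._≈_ S) → MeasurableSpace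
  generate S G G-respects = record
    { setoid         = S
    ; IsEvent        = σ G
    ; whole-event    = whole
    ; compl-event    = compl
    ; union-event    = union
    ; ext-event      = ext
    ; event-respects = respects
    }
    where
    open Setoid S using (_≈_) renaming (sym to ≈-sym)

    respects : ∀ {E} → σ G E → E Respects _≈_
    respects (gen g)             x≈y = G-respects g x≈y
    respects whole               x≈y = λ _ → tt
    respects (compl e)           x≈y x∉E y∈E = x∉E (respects e (≈-sym x≈y) y∈E)
    respects (union e)           x≈y (k , x∈E) = k , respects (e k) x≈y x∈E
    respects (ext (E⊆F , F⊆E) e) x≈y x∈F = E⊆F (respects e x≈y (F⊆E x∈F))

  module _ (Y : MeasurableSpace) where
    open MeasurableSpace Y using (whole-event; compl-event; union-event; ext-event)

    wholeᵉ : Event Y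
    wholeᵉ = _ , whole-event

    complᵉ : Event Y → Event Y
    complᵉ (E , e) = ∁ E , compl-event e

    unionᵉ : (ℕ → Event Y) → Event Y
    unionᵉ E = ⋃ ℕ (proj₁ ∘ E) , union-event (proj₂ ∘ E)

    interᵉ : Event Y → Event Y → Event Y
    interᵉ (E , e) (F , f) = E ∩ F , ext-event (to , from) (compl-event (union-event cs-event))
      where
      cs : ℕ → Pred (Carrier Y) 0ℓ
      cs zero    = ∁ E
      cs (suc _) = ∁ F

      cs-event : ∀ k → IsEvent Y (cs k)
      cs-event zero    = compl-event e
      cs-event (suc _) = compl-event f

      to : ∁ (⋃ ℕ cs) ⊆ E ∩ F
      to h = decidable-stable em (λ x∉E → h (0 , x∉E)) ,
             decidable-stable em (λ x∉F → h (1 , x∉F))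

      from : E ∩ F ⊆ ∁ (⋃ ℕ cs)
      from (x∈E , x∈F) (zero  , x∉E) = x∉E x∈E
      from (x∈E , x∈F) (suc _ , x∉F) = x∉F x∈F

  infixr 0 _→ₘ_

  record _→ₘ_ (Y Z : MeasurableSpace) : Set (lsuc ℓ) where
    field
      func       : Func (setoid Y) (setoid Z)

    open Func func public

    field
      measurable : ∀ {E} → IsEvent Z E → IsEvent Y (to ⊢ E)

    preimage : Event Z → Event Y
    preimage (E , e) = to ⊢ E , measurable e

  open _→ₘ_ using (func; to; cong; measurable; preimage)

  infixr 9 _∘ₘ_

  _∘ₘ_ : ∀ {Y Z W} → (Z →ₘ W) → (Y →ₘ Z) → (Y →ₘ W)
  g ∘ₘ f = record
    { func       = record { to = to g ∘ to f ; cong = cong g ∘ cong f }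
    ; measurable = measurable f ∘ measurable g
    }

  measurable-on-generators :
    ∀ (Y : MeasurableSpace) {z} {Z : Set z} {g} {G : Pred (Pred Z 0ℓ) g} (f : Carrier Y → Z) →
    (∀ {E} → G E → IsEvent Y (f ⊢ E)) → ∀ {E} → σ G E → IsEvent Y (f ⊢ E)
  measurable-on-generators Y {G = G} f on-G = go
    where
    open MeasurableSpace Y using (whole-event; compl-event; union-event; ext-event)

    go : ∀ {E} → σ G E → IsEvent Y (f ⊢ E)
    go (gen g)             = on-G g
    go whole               = whole-event
    go (compl e)           = compl-event (go e)
    go (union e)           = union-event (λ k → go (e k))
    go (ext (E⊆F , F⊆E) e) = ext-event (E⊆F , F⊆E) (go e)

  ----------------------------------------------------------------------
  -- Probability measures

  record Prob (Y : MeasurableSpace) : Set (lsuc ℓ) where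
    field
      measure  : Event Y → ℝ
      respects : ∀ E F → proj₁ E ≐ proj₁ F → measure E ≃ measure F
      nonneg   : ∀ E → 0ℝ ≤ measure E
      total    : measure (wholeᵉ Y) ≃ 1ℝ
      -- The terms are nonnegative, so the series is the supremum of its
      -- partial sums.
      additive : ∀ (E : ℕ → Event Y) → (∀ {j k} → j ≢ k → proj₁ (E j) DisjointFrom proj₁ (E k)) →
                 IsSup (λ y → ∃ λ N → y ≡ partialSum (measure ∘ E) N) (measure (unionᵉ Y E))

  open Prob using (measure; respects; nonneg; total; additive)

  infix 4 _≈ᵖ_

  _≈ᵖ_ : ∀ {Y} → Prob Y → Prob Y → Set (lsuc ℓ)
  μ ≈ᵖ ν = ∀ E → measure μ E ≃ measure ν E

  IsOuterMeasure : ∀ {Y a} → Prob Y → Pred (Carrier Y) a → ℝ → Set (lsuc ℓ ⊔ a)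
  IsOuterMeasure {Y} μ A = IsInf (λ y → Σ[ E ∈ Event Y ] (A ⊆ proj₁ E × y ≡ measure μ E))

  IsDirac : ∀ {Y} → Carrier Y → Prob Y → Set (lsuc ℓ)
  IsDirac t μ = ∀ E → (t ∈ proj₁ E → measure μ E ≃ 1ℝ) × (t ∉ proj₁ E → measure μ E ≃ 0ℝ)

  𝓑 : ∀ {Y} → 𝕀 → Event Y → Pred (Prob Y) 0ℓ
  𝓑 (θ , _) E μ = θ ≤ measure μ E

  Δ : MeasurableSpace → MeasurableSpace
  Δ Y = generate
    (record
      { Carrier       = Prob Y
      ; _≈_           = _≈ᵖ_
      ; isEquivalence = record
        { refl  = λ E → (λ q → q) , (λ q → q)
        ; sym   = λ μ≈ν E → proj₂ (μ≈ν E) , proj₁ (μ≈ν E)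
        ; trans = λ μ≈ν ν≈κ E → proj₁ (ν≈κ E) ∘ proj₁ (μ≈ν E) , proj₂ (μ≈ν E) ∘ proj₂ (ν≈κ E)
        }
      })
    (λ A → ∃₂ λ θ E → A ≐ 𝓑 θ E)
    (λ (_ , E , A⊆𝓑 , 𝓑⊆A) μ≈ν μ∈A → 𝓑⊆A (proj₁ (μ≈ν E) ∘ A⊆𝓑 μ∈A))

  pushforward : ∀ {Y Z} → (Y →ₘ Z) → Prob Y → Prob Z
  pushforward {Y} {Z} f μ = record
    { measure  = measure μ ∘ preimage f
    ; respects = λ E F (E⊆F , F⊆E) → respects μ (preimage f E) (preimage f F) (E⊆F , F⊆E)
    ; nonneg   = nonneg μ ∘ preimage f
    ; total    = let p = respects μ (preimage f (wholeᵉ Z)) (wholeᵉ Y) ((λ _ → tt) , (λ _ → tt))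
                 in proj₁ (total μ) ∘ proj₁ p , proj₂ p ∘ proj₂ (total μ)
    ; additive = λ E disjoint →
        let p       = respects μ (preimage f (unionᵉ Z E)) (unionᵉ Y (preimage f ∘ E))
                        ((λ x → x) , (λ x → x))
            ub , lub = additive μ (preimage f ∘ E) (λ j≢k → disjoint j≢k)
        in (λ y y∈ → proj₂ p ∘ ub y y∈) , (λ z bound → lub z bound ∘ proj₁ p)
    }

  pushforwardₘ : ∀ {Y Z} → (Y →ₘ Z) → (Δ Y →ₘ Δ Z)
  pushforwardₘ {Y} f = record
    { func       = record { to = pushforward f ; cong = λ μ≈ν E → μ≈ν (preimage f E) }
    ; measurable = measurable-on-generators (Δ Y) (pushforward f)
        (λ (θ , E , A⊆𝓑 , 𝓑⊆A) → gen (θ , preimage f E , A⊆𝓑 , 𝓑⊆A))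
    }

  ----------------------------------------------------------------------
  -- The product space X × ∏ᵢ Tᵢ

  module _ (X : MeasurableSpace) (T : Fin n → MeasurableSpace) where
    private
      module X = Setoid (setoid X)
      module T i = Setoid (setoid (T i))

    productSetoid : Setoid (lsuc ℓ) (lsuc ℓ)
    productSetoid = record
      { Carrier       = X.Carrier × (∀ i → T.Carrier i)
      ; _≈_           = λ (x , t) (y , u) → x X.≈ y × (∀ i → T._≈_ i (t i) (u i))
      ; isEquivalence = record
        { refl  = X.refl , λ i → T.refl i
        ; sym   = λ (p , q) → X.sym p , λ i → T.sym i (q i)
        ; trans = λ (p , q) (p′ , q′) → X.trans p p′ , λ i → T.trans i (q i) (q′ i)
        }
      }

    data Cylinder : Pred (Pred (Setoid.Carrier productSetoid) 0ℓ) (lsuc ℓ) where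
      state : ∀ {A} → IsEvent X A → Cylinder (proj₁ ⊢ A)
      type  : ∀ i {B} → IsEvent (T i) B → Cylinder ((λ (_ , t) → t i) ⊢ B)

    _⊗_ : MeasurableSpace
    _⊗_ = generate productSetoid Cylinder λ where
      (state a)  (p , _) → MeasurableSpace.event-respects X a p
      (type i b) (_ , q) → MeasurableSpace.event-respects (T i) b (q i)

    projᵀ : ∀ i → _⊗_ →ₘ T i
    projᵀ i = record
      { func       = record { to = λ (_ , t) → t i ; cong = λ (_ , q) → q i }
      ; measurable = λ b → gen (type i b)
      }

  ----------------------------------------------------------------------
  -- Type spaces with state space X

  record BeliefMaps (X : MeasurableSpace) (T : Fin n → MeasurableSpace) : Set (lsuc ℓ) where
    field
      β        : ∀ i → T i →ₘ Δ (X ⊗ T)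
      marginal : ∀ i (t : Carrier (T i)) → IsDirac t (pushforward (projᵀ X T i) (to (β i) t))

  record TypeSpace (X : MeasurableSpace) : Set (lsuc (lsuc ℓ)) where
    field
      T           : Fin n → MeasurableSpace
      beliefMaps  : BeliefMaps X T

    open BeliefMaps beliefMaps public

  module _ {X : MeasurableSpace} (𝒯 𝒯′ : TypeSpace X) where
    private
      module 𝒯  = TypeSpace 𝒯
      module 𝒯′ = TypeSpace 𝒯′

    TypeFunctions : Set (lsuc ℓ)
    TypeFunctions = ∀ i → Func (setoid (𝒯.T i)) (setoid (𝒯′.T i))

    _≈ᶠ_ : TypeFunctions → TypeFunctions → Set (lsuc ℓ)
    f ≈ᶠ g = ∀ i t → MeasurableSpace._≈_ (𝒯′.T i) (Func.to (f i) t) (Func.to (g i) t)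

    joint : TypeFunctions → Carrier (X ⊗ 𝒯.T) → Carrier (X ⊗ 𝒯′.T)
    joint f (x , t) = x , λ i → Func.to (f i) (t i)

    IsTypeMorphism : Pred TypeFunctions (lsuc ℓ)
    IsTypeMorphism f =
      Σ[ f⁻¹-event ∈ (∀ {E} → IsEvent (X ⊗ 𝒯′.T) E → IsEvent (X ⊗ 𝒯.T) (joint f ⊢ E)) ]
      (∀ i (t : Carrier (𝒯.T i)) E (e : IsEvent (X ⊗ 𝒯′.T) E) →
         measure (to (𝒯′.β i) (Func.to (f i) t)) (E , e) ≃
         measure (to (𝒯.β i) t) (joint f ⊢ E , f⁻¹-event e))

  IsUniversal : ∀ {X} → TypeSpace X → Set (lsuc (lsuc ℓ))
  IsUniversal {X} 𝒯* = ∀ (𝒯 : TypeSpace X) → ∃! (_≈ᶠ_ 𝒯 𝒯*) (IsTypeMorphism 𝒯 𝒯*)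

  record MeasurableIso (X Y : MeasurableSpace) : Set (lsuc ℓ) where
    field
      forward  : X →ₘ Y
      backward : Y →ₘ X
      left     : ∀ x → MeasurableSpace._≈_ X (to backward (to forward x)) x
      right    : ∀ y → MeasurableSpace._≈_ Y (to forward (to backward y)) y

  -- Identify the state space of a type space with an isomorphic one.
  relabel : ∀ {S X} → MeasurableIso S X → TypeSpace S → TypeSpace X
  relabel {S} {X} ι 𝒯 = record
    { T          = T
    ; beliefMaps = record
      { β        = λ i → pushforwardₘ ι×id ∘ₘ β i
      ; marginal = λ i t (E , e) →
          let same = respects (to (β i) t) (preimage ι×id (preimage (projᵀ X T i) (E , e)))
                       (preimage (projᵀ S T i) (E , e)) ((λ x → x) , (λ x → x))
              in-E , out-E = marginal i t (E , e)
          in (λ t∈E → let p = in-E t∈E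
                      in proj₁ p ∘ proj₁ same , proj₂ same ∘ proj₂ p) ,
             (λ t∉E → let p = out-E t∉E
                      in proj₁ p ∘ proj₁ same , proj₂ same ∘ proj₂ p)
      }
    }
    where
    open TypeSpace 𝒯
    open MeasurableIso ι

    ι×id : S ⊗ T →ₘ X ⊗ T
    ι×id = record
      { func       = record
        { to   = λ (s , t) → to forward s , t
        ; cong = λ (p , q) → cong forward p , q
        }
      ; measurable = measurable-on-generators (S ⊗ T) (λ (s , t) → to forward s , t) λ where
          (state a)  → gen (state (measurable forward a))
          (type i b) → gen (type i b)
      }

  ----------------------------------------------------------------------
  -- The language over a set Φ of primitive propositions, and its models

  module Language (Φ : Setoid (lsuc ℓ) (lsuc ℓ)) where
    private
      module Φ = Setoid Φ

    infixr 6 _∧′_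
    infix  7 ¬′_

    data Formula : Set (lsuc ℓ) where
      prop : Φ.Carrier → Formula
      ¬′_  : Formula → Formula
      _∧′_ : Formula → Formula → Formula
      B    : Fin n → 𝕀 → Formula → Formula

    Formulas : Set (lsuc ℓ)
    Formulas = Pred Formula 0ℓ

    record Frame (Ω : MeasurableSpace) : Set (lsuc ℓ) where
      field
        Pr            : Fin n → Ω →ₘ Δ Ω
        introspective : ∀ i ω →
          IsOuterMeasure (to (Pr i) ω) (λ ω′ → to (Pr i) ω′ ≈ᵖ to (Pr i) ω) 1ℝ

    record Model : Set (lsuc (lsuc ℓ)) where
      field
        Ω      : MeasurableSpace
        frame  : Frame Ω
        π      : Φ.Carrier → Event Ω
        π-cong : ∀ {p q} → p Φ.≈ q → proj₁ (π p) ≐ proj₁ (π q)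

      open Frame frame public

      ⟦_⟧ : Formula → Event Ω
      ⟦ prop p ⟧  = π p
      ⟦ ¬′ φ ⟧    = complᵉ Ω ⟦ φ ⟧
      ⟦ φ ∧′ ψ ⟧  = interᵉ Ω ⟦ φ ⟧ ⟦ ψ ⟧
      ⟦ B i θ φ ⟧ = preimage (Pr i)
        (𝓑 θ ⟦ φ ⟧ , gen (θ , ⟦ φ ⟧ , (λ x → x) , (λ x → x)))

      D : Carrier Ω → Formulas
      D ω φ = ω ∈ proj₁ ⟦ φ ⟧

    SatisfiableIn : ∀ {c} → Pred Model c → Pred Formulas (lsuc (lsuc ℓ) ⊔ c)
    SatisfiableIn C A = Σ[ M ∈ Model ] (C M × ∃ λ ω → A ⊆ Model.D M ω)

    IsDescription : Pred Formulas (lsuc (lsuc ℓ))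
    IsDescription A = SatisfiableIn (λ _ → ⊤) A × (∀ φ → φ ∈ A ⊎ ¬′ φ ∈ A)

    -- The set of all sets of formulas satisfying P, with the σ-algebra
    -- generated by the sets {A : φ ∈ A}.
    SetsOfFormulas : Pred Formulas (lsuc ℓ) → MeasurableSpace
    SetsOfFormulas P = generate
      (record
        { Carrier       = ∃ P
        ; _≈_           = λ A A′ → proj₁ A ≐ proj₁ A′
        ; isEquivalence = record
          { refl  = (λ x → x) , (λ x → x)
          ; sym   = λ (p , q) → q , p
          ; trans = λ (p , q) (p′ , q′) → (λ x → p′ (p x)) , (λ x → q (q′ x))
          }
        })
      (λ E → ∃ λ φ → E ≐ (λ A → φ ∈ proj₁ A))
      (λ (_ , E⊆ , ⊆E) (p , _) x∈E → ⊆E (p (E⊆ x∈E)))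

    --------------------------------------------------------------------
    -- The universal probability model for a class

    module _ {c} (C : Pred Model c) where

      -- Satisfiability quantifies over all models, so it lives above
      -- lsuc ℓ; the truth value True em is an equivalent small proposition.
      Ω̄ : MeasurableSpace
      Ω̄ = SetsOfFormulas
        (λ A → Lift (lsuc ℓ) (True (em {P = IsDescription A × SatisfiableIn C A})))

      hat : Formula → Event Ω̄
      hat φ = (λ ω̄ → φ ∈ proj₁ ω̄) , gen (φ , (λ x → x) , (λ x → x))

      hat-prop-⊆ : ∀ {p q} → p Φ.≈ q → proj₁ (hat (prop p)) ⊆ proj₁ (hat (prop q))
      hat-prop-⊆ {p} {q} p≈q {_ , small} p∈A with toWitness (lower small)
      ... | (_ , complete) , M , _ , ω , A⊆D with complete (prop q)
      ...   | inj₁ q∈A  = q∈A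
      ...   | inj₂ ¬q∈A = contradiction (proj₁ (Model.π-cong M p≈q) (A⊆D p∈A)) (A⊆D ¬q∈A)

      record UniversalModel : Set (lsuc (lsuc ℓ)) where
        field
          frame  : Frame Ω̄

        open Frame frame public

        field
          Pr-spec : ∀ i (ω̄ : Carrier Ω̄) → IsTheUnique _≈ᵖ_
            (λ μ → ∀ φ → IsSup (λ y → Σ[ θ ∈ 𝕀 ] (y ≡ proj₁ θ × B i θ φ ∈ proj₁ ω̄))
                               (measure μ (hat φ)))
            (to (Pr i) ω̄)

        model : Model
        model = record
          { Ω      = Ω̄
          ; frame  = frame
          ; π      = hat ∘ prop
          ; π-cong = λ p≈q → (λ {ω̄} → hat-prop-⊆ p≈q {ω̄}) , (λ {ω̄} → hat-prop-⊆ (Φ.sym p≈q) {ω̄})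
          }

    --------------------------------------------------------------------
    -- The type space of a model

    Propositional : Formulas
    Propositional (prop _)  = ⊤
    Propositional (¬′ φ)    = Propositional φ
    Propositional (φ ∧′ ψ)  = Propositional φ × Propositional ψ
    Propositional (B _ _ _) = ⊥

    -- Boolean combinations of formulas B i θ φ, for the given agent i.
    BeliefsOf : Fin n → Formulas
    BeliefsOf i (prop _)  = ⊥
    BeliefsOf i (¬′ φ)    = BeliefsOf i φ
    BeliefsOf i (φ ∧′ ψ)  = BeliefsOf i φ × BeliefsOf i ψ
    BeliefsOf i (B j _ _) = j ≡ i

    module _ (M : Model) where
      open Model M using (Ω; D)

      d₀ : Carrier Ω → Formulas
      d₀ ω = D ω ∩ Propositional

      d : Fin n → Carrier Ω → Formulas
      d i ω = D ω ∩ BeliefsOf i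

      States : MeasurableSpace
      States = SetsOfFormulas (λ x → ∃ λ ω → x ≐ d₀ ω)

      Types : Fin n → MeasurableSpace
      Types i = SetsOfFormulas (λ t → ∃ λ ω → t ≐ d i ω)

      record TypeSpaceOf : Set (lsuc (lsuc ℓ)) where
        field
          desc      : Carrier (States ⊗ Types) → Formulas
          desc-spec : ∀ x t → IsTheUnique _≐_
            (λ A → IsDescription A × proj₁ x ⊆ A × (∀ i → proj₁ (t i) ⊆ A))
            (desc (x , t))

        [_] : Formula → Pred (Carrier (States ⊗ Types)) 0ℓ
        [ φ ] xt = φ ∈ desc xt

        field
          []-event   : ∀ φ → IsEvent (States ⊗ Types) [ φ ]
          beliefMaps : BeliefMaps States Types

        open BeliefMaps beliefMaps

        field
          β-spec : ∀ i (t : Carrier (Types i)) → IsTheUnique _≈ᵖ_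
            (λ μ → ∀ φ θ → (proj₁ θ ≤ measure μ ([ φ ] , []-event φ)) ⇔ B i θ φ ∈ proj₁ t)
            (to (β i) t)

        typeSpace : TypeSpace States
        typeSpace = record { T = Types ; beliefMaps = beliefMaps }

  ----------------------------------------------------------------------

  -- Singletons are compared with Set₀-valued subsets by ≐, as X._≈_ need
  -- not be Set₀-valued.
  GeneratedBySingletons : MeasurableSpace → Set (lsuc ℓ)
  GeneratedBySingletons X = ∀ E → IsEvent X E ⇔ σ (λ F → ∃ λ x → F ≐ (λ y → y X.≈ x)) E
    where module X = MeasurableSpace X

  module _ (X : MeasurableSpace) where
    private
      module X = MeasurableSpace X

    open Language X.setoid

    -- Every world lies in exactly one of the sets π x.
    Partitioned : Pred Model (lsuc ℓ)
    Partitioned M = ∀ ω → ∃! X._≈_ (λ x → ω ∈ proj₁ (Model.π M x))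

    -- The objects that are determined only up to equality by their
    -- defining properties: the universal model for the class, its type
    -- space, and the identification of the states of the latter with X.
    record UniversalModelTypeSpace : Set (lsuc (lsuc ℓ)) where
      field
        M̄       : UniversalModel Partitioned

      open UniversalModel M̄ public using (model)

      field
        𝒯       : TypeSpaceOf model
        ι       : MeasurableIso (States model) X
        matches : ∀ s → IsTheUnique X._≈_ (λ x → prop x ∈ proj₁ s)
                          (to (MeasurableIso.forward ι) s)

      typeSpace : TypeSpace X
      typeSpace = relabel ι (TypeSpaceOf.typeSpace 𝒯)

{-# OPTIONS --safe #-}

-- Apart from point masses, every measure that is needed is the image of a given
-- one, so no extension theorem for measures enters.  The beliefs at a description D(ω) are the image of
-- the beliefs at ω under ω′ ↦ D(ω′); they do not depend on the choice of ω, since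
-- truth sets are closed under intersection and a measure is determined by its
-- values on a generating π-system.  A propositional part and one belief part for
-- each agent, taken from different worlds, are realised together at a world added
-- to the model, so descriptions correspond to points of S × T.
--
-- A type space over X is itself a partitioned model on X × T with
-- Prᵢ(x,t) = βᵢ(tᵢ); reading off the beliefs of i at (x,t) gives the type morphism.
-- Under any morphism the description of the image of (x,t) is, by induction on
-- formulas, the description of (x,t), whence uniqueness.

module Submission where

open import Defs
open import Axiom.ExcludedMiddle using (ExcludedMiddle)
open import Data.Empty using (⊥)
open import Data.Fin.Base using (Fin)
open import Data.Fin.Properties using (_≟_)
open import Data.Integer.Base using (+_; -[1+_])
open import Data.Maybe.Base using (just; nothing; maybe′)
open import Data.Maybe.Relation.Binary.Pointwise as Pointwise using (just; nothing)
open import Data.Nat.Base as ℕ using (ℕ; zero; suc)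
import Data.Nat.Properties as ℕₚ
open import Data.Product using (Σ; Σ-syntax; ∃; ∃₂; ∃!; _×_; _,_; proj₁; proj₂)
open import Data.Rational as ℚ using (ℚ; 0ℚ; 1ℚ)
import Data.Rational.Properties as ℚₚ
open import Data.Rational.Solver using (module +-*-Solver)
open import Data.Sum.Base using (_⊎_; inj₁; inj₂)
open import Data.Unit.Base using (⊤; tt)
open import Function.Base using (_∘_; id)
open import Function.Bundles using (Func; _⇔_; mk⇔; module Equivalence)
open import Level using (Level; 0ℓ; _⊔_; lift; lower) renaming (suc to lsuc)
open import Relation.Binary.Bundles using (Setoid)
open import Relation.Binary.Definitions using (tri<; tri≈; tri>)
open import Relation.Binary.PropositionalEquality using (_≡_; _≢_; refl; sym; subst)
open import Relation.Nullary using (Dec; contradiction; yes; no; ¬_)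
open import Relation.Nullary.Decidable using (decidable-stable; fromWitness; toWitness; True)
open import Relation.Unary renaming (_⊥_ to _DisjointFrom_)
open import Relation.Unary.Properties using (≐-refl; ≐-sym; ≐-trans)

open ℝ
open +-*-Solver using (solve; _:=_; _:+_; :-_)

-- The σ-algebras are not assumed to be countably generated, so a set such as {ω′ : Prᵢ(ω′) =
-- Prᵢ(ω)} or {t} may fail to be an event. Fullness is therefore always shown for every event that
-- includes the set, and for a type space this takes a comparison of events with their sections. The
-- defining properties speak of truth sets only, while measurability into `Δ` concerns all events.
-- The π-λ argument is thus needed twice: for the equality of two measures, and for the
-- measurability of y ↦ κ(y)(E). All reals in [0,1] are thresholds of the language. Hence the
-- supremum that defines the universal beliefs is attained, at the threshold equal to the measure
-- itself, and supremum conditions can be exchanged for threshold conditions. Universality is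
-- claimed for every object that meets the specification. Its proof uses only the specified
-- properties of the universal model, its type space and the identification of states; the
-- constructions show that such an object exists.

-- Arithmetic of lower cuts

sub-<⇒<-add : ∀ a b {c} → a ℚ.- b ℚ.< c → a ℚ.< b ℚ.+ c
sub-<⇒<-add a b {c} a-b<c =
  subst (ℚ._< b ℚ.+ c) (solve 2 (λ a b → b :+ (a :+ :- b) := a) refl a b) (ℚₚ.+-monoʳ-< b a-b<c)

<-add⇒sub-< : ∀ a b {c} → a ℚ.< b ℚ.+ c → a ℚ.- b ℚ.< c
<-add⇒sub-< a b {c} a<b+c =
  subst (a ℚ.- b ℚ.<_) (solve 2 (λ b c → (b :+ c) :+ :- b := c) refl b c)
    (ℚₚ.+-monoˡ-< (ℚ.- b) a<b+c)

∈-∉⇒< : ∀ x {p q} → p ∈ Lower x → q ∉ Lower x → p ℚ.< q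
∈-∉⇒< x {p} {q} p∈x q∉x with ℚₚ.<-cmp p q
... | tri< p<q _ _  = p<q
... | tri≈ _ refl _ = contradiction p∈x q∉x
... | tri> _ _ q<p  = contradiction (downward x q<p p∈x) q∉x

fromℚ-≤ : ∀ x {q} → q ∈ Lower x → fromℚ q ≤ x
fromℚ-≤ x q∈x p<q = downward x p<q q∈x

+-mono : ∀ x x′ y y′ → x ≤ x′ → y ≤ y′ → x + y ≤ x′ + y′
+-mono x x′ y y′ x≤x′ y≤y′ (r , s , r∈x , s∈y , q<r+s) = r , s , x≤x′ r∈x , y≤y′ s∈y , q<r+s

+-comm-≤ : ∀ x y → x + y ≤ y + x
+-comm-≤ x y {q} (r , s , r∈x , s∈y , q<r+s) =
  s , r , s∈y , r∈x , subst (q ℚ.<_) (ℚₚ.+-comm r s) q<r+s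

-- Roundedness leaves a gap q < p below `x`, and a negative s > q - p closes it; every negative
-- rational is below `y`.
x≤x+y : ∀ x y → 0ℝ ≤ y → x ≤ x + y
x≤x+y x y 0≤y {q} q∈x =
  let p , q<p , p∈x = rounded x q∈x
      s , q-p<s , s<0 = ℚₚ.<-dense (<-add⇒sub-< q p (subst (q ℚ.<_) (sym (ℚₚ.+-identityʳ p)) q<p))
  in p , s , p∈x , 0≤y s<0 , sub-<⇒<-add q p q-p<s

y≤x+y : ∀ x y → 0ℝ ≤ x → y ≤ x + y
y≤x+y x y 0≤x = +-comm-≤ y x ∘ x≤x+y y x 0≤x

x+y≤x : ∀ x y → y ≤ 0ℝ → x + y ≤ x
x+y≤x x y y≤0 {q} (r , s , r∈x , s∈y , q<r+s) =
  downward x (subst (q ℚ.<_) (ℚₚ.+-identityʳ r) (ℚₚ.<-trans q<r+s (ℚₚ.+-monoʳ-< r (y≤0 s∈y)))) r∈x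

x+y≤y : ∀ x y → x ≤ 0ℝ → x + y ≤ y
x+y≤y x y x≤0 = x+y≤x y x x≤0 ∘ +-comm-≤ x y

sup-unique : ∀ {p} {P : Pred ℝ p} x y → IsSup P x → IsSup P y → x ≃ y
sup-unique x y (ub , lub) (ub′ , lub′) = lub y ub′ , lub′ x ub

-- If x + y = 1, then q < y iff 1 − r ∉ x for some r > q: cuts need not be subtracted.
complementary-∈ : ∀ x y → x + y ≃ 1ℝ → ∀ {q} → q ∈ Lower y → ∃ λ r → q ℚ.< r × (1ℚ ℚ.- r) ∉ Lower x
complementary-∈ x y (x+y≤1 , _) q∈y =
  let r , q<r , r∈y = rounded y q∈y
      s , r<s , s∈y = rounded y r∈y
  in r , q<r , λ 1-r∈x → ℚₚ.<-irrefl refl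
       (x+y≤1 {1ℚ} (1ℚ ℚ.- r , s , 1-r∈x , s∈y ,
         subst (1ℚ ℚ.<_) (ℚₚ.+-comm s _) (sub-<⇒<-add 1ℚ s
           (ℚₚ.+-monoʳ-< 1ℚ (ℚₚ.neg-antimono-< r<s)))))

-- As 1 - r + q < 1, it is less than some a + b with a below `x` and b below `y`. Since 1 - r is not
-- below `x`, it exceeds a, which leaves q < b.
∈-complementary : ∀ x y → x + y ≃ 1ℝ → ∀ {q r} → q ℚ.< r → (1ℚ ℚ.- r) ∉ Lower x → q ∈ Lower y
∈-complementary x y (_ , 1≤x+y) {q} {r} q<r 1-r∉x =
  let a , b , a∈x , b∈y , 1-r+q<a+b = 1≤x+y 1-r+q<1
      a<1-r = ∈-∉⇒< x a∈x 1-r∉x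
  in downward y
       (subst₂< (solve 2 (λ c q → :- c :+ (c :+ q) := q) refl (1ℚ ℚ.- r) q)
                (solve 2 (λ c b → :- c :+ (c :+ b) := b) refl (1ℚ ℚ.- r) b)
          (ℚₚ.+-monoʳ-< (ℚ.- (1ℚ ℚ.- r)) (ℚₚ.<-trans 1-r+q<a+b (ℚₚ.+-monoˡ-< b a<1-r))))
       b∈y
  where
  subst₂< : ∀ {a a′ b b′} → a ≡ a′ → b ≡ b′ → a ℚ.< b → a′ ℚ.< b′
  subst₂< refl refl a<b = a<b

  1-r+q<1 : (1ℚ ℚ.- r) ℚ.+ q ℚ.< 1ℚ
  1-r+q<1 = subst ((1ℚ ℚ.- r) ℚ.+ q ℚ.<_)
    (solve 2 (λ o r → (o :+ :- r) :+ r := o) refl 1ℚ r) (ℚₚ.+-monoʳ-< (1ℚ ℚ.- r) q<r)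

-- Replaces y = 1 - x in the complement step of the uniqueness of measures.
complementary-≤ : ∀ x x′ y y′ → x + y ≃ 1ℝ → x′ + y′ ≃ 1ℝ → x ≤ x′ → y′ ≤ y
complementary-≤ x x′ y y′ p p′ x≤x′ q∈y′ =
  let r , q<r , 1-r∉x′ = complementary-∈ x′ y′ p′ q∈y′
  in ∈-complementary x y p q<r (1-r∉x′ ∘ x≤x′)

-- Partial sums, thresholds and cancellation

module _ (f g : ℕ → ℝ) where
  partialSum-mono : (∀ k → f k ≤ g k) → ∀ N → partialSum f N ≤ partialSum g N
  partialSum-mono f≤g zero    = id
  partialSum-mono f≤g (suc N) =
    +-mono (partialSum f N) (partialSum g N) (f N) (g N) (partialSum-mono f≤g N) (f≤g N)

partialSum-≤0 : ∀ f → (∀ k → f k ≤ 0ℝ) → ∀ N → partialSum f N ≤ 0ℝ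
partialSum-≤0 f f≤0 zero    = id
partialSum-≤0 f f≤0 (suc N) = partialSum-≤0 f f≤0 N ∘ x+y≤x (partialSum f N) (f N) (f≤0 N)

PartialSums : (ℕ → ℝ) → Pred ℝ (lsuc 0ℓ)
PartialSums f y = ∃ λ N → y ≡ partialSum f N

partialSums-sup-mono : ∀ f g x y → (∀ k → f k ≤ g k) → 
  IsSup (PartialSums f) x → IsSup (PartialSums g) y → x ≤ y
partialSums-sup-mono f g x y f≤g (_ , lub) (ub , _) =
  lub y λ { _ (N , refl) → ub _ (N , refl) ∘ partialSum-mono f g f≤g N }

-- The union of the cuts of the partial sums is itself a cut.
∈-sup : ∀ f x {q} → IsSup (PartialSums f) x → q ∈ Lower x → ∃ λ N → q ∈ Lower (partialSum f N)
∈-sup f x (ub , lub) q∈x = lub ⋃f (λ { _ (N , refl) q∈ → N , q∈ }) q∈x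
  where
  ⋃f : ℝ
  ⋃f = record
    { Lower     = λ q → ∃ λ N → q ∈ Lower (partialSum f N)
    ; inhabited = let q , q∈ = inhabited 0ℝ in q , 0 , q∈
    ; bounded   = let q , q∉ = bounded x in q , λ (N , q∈) → q∉ (ub _ (N , refl) q∈)
    ; downward  = λ p<q (N , q∈) → N , downward (partialSum f N) p<q q∈
    ; rounded   = λ (N , p∈) → let q , p<q , q∈ = rounded (partialSum f N) p∈ in q , p<q , N , q∈
    }

-- The σ-algebra of `Δ` tests thresholds in [0,1] only, whereas a cut also contains negative
-- rationals; for those the threshold 0 serves.
∈⇒threshold : ∀ x {q} → 0ℝ ≤ x → x ≤ 1ℝ → q ∈ Lower x →
  ∃ λ r → q ℚ.< r × (0ℝ ≤ fromℚ r × fromℚ r ≤ 1ℝ) × fromℚ r ≤ x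
∈⇒threshold x {q} 0≤x x≤1 q∈x with ℚₚ.<-cmp q 0ℚ
... | tri< q<0 _ _ = 0ℚ , q<0 , (id , fromℚ-≤ 1ℝ (ℚₚ.positive⁻¹ 1ℚ)) , 0≤x
... | tri≈ _ refl _ = let r , q<r , r∈x = rounded x q∈x
                      in r , q<r , ((λ p<0 → ℚₚ.<-trans p<0 q<r) , fromℚ-≤ 1ℝ (x≤1 r∈x)) ,
                           fromℚ-≤ x r∈x
... | tri> _ _ 0<q = let r , q<r , r∈x = rounded x q∈x
                         0<r = ℚₚ.<-trans 0<q q<r
                     in r , q<r , ((λ p<0 → ℚₚ.<-trans p<0 0<r) , fromℚ-≤ 1ℝ (x≤1 r∈x)) ,
                        fromℚ-≤ x r∈x

¬1≤0 : 1ℝ ≤ 0ℝ → ∀ {a} {A : Set a} → A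
¬1≤0 1≤0 = contradiction (1≤0 {0ℚ} (ℚₚ.positive⁻¹ 1ℚ)) (ℚₚ.<-irrefl refl)

-- Were 0 below `x`, a positive p would be as well, and any r with 1 - p < r < 1 would put 1 below 1
-- + `x`.
1+x≤1⇒x≤0 : ∀ x → 1ℝ + x ≤ 1ℝ → x ≤ 0ℝ
1+x≤1⇒x≤0 x 1+x≤1 q∈x = ∈-∉⇒< x q∈x λ 0∈x → ℚₚ.<-irrefl refl (1+x≤1 (1∈1+x 0∈x))
  where
  1∈1+x : 0ℚ ∈ Lower x → 1ℚ ∈ Lower (1ℝ + x)
  1∈1+x 0∈x =
    let p , 0<p , p∈x = rounded x 0∈x
        r , 1-p<r , r<1 = ℚₚ.<-dense (<-add⇒sub-< 1ℚ p
                            (subst (ℚ._< p ℚ.+ 1ℚ) (ℚₚ.+-identityˡ 1ℚ) (ℚₚ.+-monoˡ-< 1ℚ 0<p)))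
    in r , p , r<1 , p∈x , subst (1ℚ ℚ.<_) (ℚₚ.+-comm p r) (sub-<⇒<-add 1ℚ p 1-p<r)

module _ (em : ∀ {a} → ExcludedMiddle a) (ℓ : Level) (n : ℕ) where
  open Theory em ℓ n
  open MeasurableSpace using (Carrier; setoid; IsEvent; Event)
  open Prob using (measure; respects; nonneg; total; additive)

  by-contradiction : ∀ {a} {A : Set a} → ¬ ¬ A → A
  by-contradiction = decidable-stable em

  -- Enumeration of the rationals and disjoint refinements

  -- Numerator, denominator and sign are separate natural numbers, so a union over ℚ becomes three
  -- nested unions over ℕ without a pairing function.
  rational : ℕ → ℕ → ℕ → ℚ
  rational a b zero    = + a ℚ./ suc b
  rational a b (suc _) = -[1+ a ] ℚ./ suc b

  rational-surjective : ∀ q → ∃ λ a → ∃₂ λ b c → rational a b c ≡ q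
  rational-surjective q@(ℚ.mkℚ (+ a)    b _) = a , b , 0 , ℚₚ.↥p/↧p≡p q
  rational-surjective q@(ℚ.mkℚ -[1+ a ] b _) = a , b , 1 , ℚₚ.↥p/↧p≡p q

  module _ {a} {Y : Set a} where

    -- Disjointification written with intersections and complements only, so that closure under
    -- these two operations suffices to stay inside a Dynkin system.
    before fresh : (ℕ → Pred Y 0ℓ) → ℕ → Pred Y 0ℓ
    before E zero    = U
    before E (suc k) = before E k ∩ ∁ (E k)
    fresh E k = E k ∩ before E k

    module _ (E : ℕ → Pred Y 0ℓ) where
      before-∉ : ∀ {j k y} → j ℕ.< k → before E k y → y ∉ E j
      before-∉ {j} {suc k} (ℕ.s≤s j≤k) (y∈ , y∉Ek) with ℕₚ.m≤n⇒m<n∨m≡n j≤k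
      ... | inj₁ j<k  = before-∉ j<k y∈
      ... | inj₂ refl = y∉Ek

      fresh-disjoint : ∀ {j k} → j ≢ k → fresh E j DisjointFrom fresh E k
      fresh-disjoint {j} {k} j≢k ((y∈j , j-before) , (y∈k , k-before)) with ℕₚ.<-cmp j k
      ... | tri< j<k _ _ = before-∉ j<k k-before y∈j
      ... | tri≈ _ j≡k _ = j≢k j≡k
      ... | tri> _ _ k<j = before-∉ k<j j-before y∈k

      before-or-fresh : ∀ k y → before E k y ⊎ ∃ λ j → fresh E j y
      before-or-fresh zero    y = inj₁ tt
      before-or-fresh (suc k) y with before-or-fresh k y | em {P = E k y}
      ... | inj₂ found | _      = inj₂ found
      ... | inj₁ y∈    | yes y∈k = inj₂ (k , y∈k , y∈)
      ... | inj₁ y∈    | no y∉k  = inj₁ (y∈ , y∉k)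

      ⋃-fresh : ⋃ ℕ (fresh E) ≐ ⋃ ℕ E
      ⋃-fresh = (λ (k , y∈k , _) → k , y∈k) , λ {y} (k , y∈k) → from k y y∈k
        where
        from : ∀ k y → E k y → ∃ λ j → fresh E j y
        from k y y∈k with before-or-fresh k y
        ... | inj₁ y∈    = k , y∈k , y∈
        ... | inj₂ found = found

    -- Finite additivity is countable additivity padded with empty sets; as `∁ U` these are events
    -- by closure under complements.
    pair : Pred Y 0ℓ → Pred Y 0ℓ → ℕ → Pred Y 0ℓ
    pair E F zero          = E
    pair E F (suc zero)    = F
    pair E F (suc (suc _)) = ∁ U

    pair-disjoint : ∀ {E F} → E DisjointFrom F → ∀ {j k} → j ≢ k →
      pair E F j DisjointFrom pair E F k
    pair-disjoint E⊥F {zero}        {zero}        j≢k = λ _ → j≢k refl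
    pair-disjoint E⊥F {zero}        {suc zero}    j≢k = E⊥F
    pair-disjoint E⊥F {suc zero}    {zero}        j≢k = λ (y∈F , y∈E) → E⊥F (y∈E , y∈F)
    pair-disjoint E⊥F {suc zero}    {suc zero}    j≢k = λ _ → j≢k refl
    pair-disjoint E⊥F {_}           {suc (suc _)} j≢k = λ (_ , y∉U) → y∉U tt
    pair-disjoint E⊥F {suc (suc _)} {_}           j≢k = λ (y∉U , _) → y∉U tt

    ⋃-pair : ∀ {E F} → ⋃ ℕ (pair E F) ≐ E ∪ F
    ⋃-pair {E} {F} = to , from
      where
      to : ⋃ ℕ (pair E F) ⊆ E ∪ F
      to (zero        , y∈E) = inj₁ y∈E
      to (suc zero    , y∈F) = inj₂ y∈F
      to (suc (suc _) , y∉U) = contradiction tt y∉U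

      from : E ∪ F ⊆ ⋃ ℕ (pair E F)
      from (inj₁ y∈E) = 0 , y∈E
      from (inj₂ y∈F) = 1 , y∈F

  -- Dynkin systems and the π-λ theorem

  module _ {a g} {Y : Set a} (G : Pred (Pred Y 0ℓ) g) where

    data Dynkin : Pred (Pred Y 0ℓ) (lsuc 0ℓ ⊔ a ⊔ g) where
      gen   : ∀ {E} → G E → Dynkin E
      whole : Dynkin (λ _ → ⊤)
      compl : ∀ {E} → Dynkin E → Dynkin (∁ E)
      union : ∀ {E : ℕ → Pred Y 0ℓ} → (∀ {j k} → j ≢ k → E j DisjointFrom E k) →
              (∀ k → Dynkin (E k)) → Dynkin (⋃ ℕ E)
      ext   : ∀ {E F} → E ≐ F → Dynkin E → Dynkin F

    disjoint-∪ : ∀ {E F} → E DisjointFrom F → Dynkin E → Dynkin F → Dynkin (E ∪ F)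
    disjoint-∪ {E} {F} E⊥F e f = ext ⋃-pair (union (pair-disjoint E⊥F) λ where
      zero          → e
      (suc zero)    → f
      (suc (suc _)) → compl whole)

    Dynkin-∩ : ∀ {A} → Dynkin A → (∀ {E} → G E → Dynkin (A ∩ E)) → ∀ {E} → Dynkin E → Dynkin (A ∩ E)
    Dynkin-∩ {A} a∈ on-G = go
      where
      go : ∀ {E} → Dynkin E → Dynkin (A ∩ E)
      go (gen g)      = on-G g
      go whole        = ext ((λ y∈A → y∈A , tt) , proj₁) a∈
      -- A minus E is the complement of the disjoint union of `∁ A` and `A ∩ E`.
      go (compl {E} e) = ext
        ((λ y∉ → by-contradiction (λ y∉A → y∉ (inj₁ y∉A)) , λ y∈E →
            y∉ (inj₂ (by-contradiction (λ y∉A → y∉ (inj₁ y∉A)) , y∈E))) ,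
         λ (y∈A , y∉E) → λ { (inj₁ y∉A) → y∉A y∈A ; (inj₂ (_ , y∈E)) → y∉E y∈E })
        (compl (disjoint-∪ {∁ A} {A ∩ E} (λ (y∉A , y∈A , _) → y∉A y∈A) (compl a∈) (go e)))
      go (union {E} disjoint e) = ext
        ((λ (k , y∈A , y∈k) → y∈A , k , y∈k) , λ (y∈A , k , y∈k) → k , y∈A , y∈k)
        (union {λ k → A ∩ E k} (λ j≢k ((_ , y∈j) , (_ , y∈k)) → disjoint j≢k (y∈j , y∈k))
          (λ k → go (e k)))
      go (ext (E⊆F , F⊆E) e) =
        ext ((λ (y∈A , y∈E) → y∈A , E⊆F y∈E) , λ (y∈A , y∈F) → y∈A , F⊆E y∈F) (go e)

    module _ (G-∩ : ∀ {E F} → G E → G F → G (E ∩ F)) where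

      -- `Dynkin-∩` is applied twice: with a generator as the fixed set, where `G-∩` handles the
      -- other generators, and then with an arbitrary fixed set, where the first application does.
      ∩-closed : ∀ {E F} → Dynkin E → Dynkin F → Dynkin (E ∩ F)
      ∩-closed {E} e = Dynkin-∩ e λ {F} g →
        ext ((λ (y∈F , y∈E) → y∈E , y∈F) , λ (y∈E , y∈F) → y∈F , y∈E)
            (Dynkin-∩ (gen g) (λ h → gen (G-∩ g h)) e)

      σ⊆Dynkin : ∀ {E} → σ G E → Dynkin E
      σ⊆Dynkin (gen g)       = gen g
      σ⊆Dynkin whole         = whole
      σ⊆Dynkin (compl e)     = compl (σ⊆Dynkin e)
      σ⊆Dynkin (union {E} e) =
        ext (⋃-fresh E) (union (fresh-disjoint E) λ k → ∩-closed (σ⊆Dynkin (e k)) (before-Dynkin k))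
        where
        before-Dynkin : ∀ k → Dynkin (before E k)
        before-Dynkin zero    = whole
        before-Dynkin (suc k) = ∩-closed (before-Dynkin k) (compl (σ⊆Dynkin (e k)))
      σ⊆Dynkin (ext p e)     = ext p (σ⊆Dynkin e)

  -- Closure properties of events

  module Events (Y : MeasurableSpace) where
    open MeasurableSpace Y using (whole-event; compl-event; union-event; ext-event)

    -- By excluded middle the set is everything or nothing. This lets side conditions such as q < r
    -- + s occur inside events.
    const-event : ∀ (P : Set) → IsEvent Y (λ _ → P)
    const-event P with em {P = P}
    ... | yes p = ext-event ((λ _ → p) , (λ _ → tt)) whole-event
    ... | no ¬p = ext-event ((λ ¬tt → contradiction tt ¬tt) , (λ p → contradiction p ¬p))
      (compl-event whole-event)

    ∩-event : ∀ {E F} → IsEvent Y E → IsEvent Y F → IsEvent Y (E ∩ F)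
    ∩-event e f = proj₂ (interᵉ Y (_ , e) (_ , f))

    before-event : ∀ {E : ℕ → Pred (Carrier Y) 0ℓ} → (∀ k → IsEvent Y (E k)) →
      ∀ k → IsEvent Y (before E k)
    before-event e zero    = whole-event
    before-event e (suc k) = ∩-event (before-event e k) (compl-event (e k))

    pair-event : ∀ {E F} → IsEvent Y E → IsEvent Y F → ∀ k → IsEvent Y (pair E F k)
    pair-event e f zero          = e
    pair-event e f (suc zero)    = f
    pair-event e f (suc (suc _)) = compl-event whole-event

    ⋂-event : ∀ {E : ℕ → Pred (Carrier Y) 0ℓ} → (∀ k → IsEvent Y (E k)) → IsEvent Y (⋂ ℕ E)
    ⋂-event {E} e = ext-event
      ((λ none k → by-contradiction (λ y∉ → none (k , y∉))) , λ all (k , y∉) → y∉ (all k))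
      (compl-event (union-event {λ k → ∁ (E k)} (λ k → compl-event (e k))))

    ⋃ℚ-event : ∀ {E : ℚ → Pred (Carrier Y) 0ℓ} → (∀ q → IsEvent Y (E q)) → IsEvent Y (⋃ ℚ E)
    ⋃ℚ-event {E} e = ext-event
      ((λ (a , b , c , y∈) → rational a b c , y∈) , λ {y} (q , y∈) →
        let a , b , c , eq = rational-surjective q in a , b , c , subst (λ q → E q y) (sym eq) y∈)
      (union-event λ a → union-event λ b → union-event λ c → e (rational a b c))

    ⋂ℚ-event : ∀ {E : ℚ → Pred (Carrier Y) 0ℓ} → (∀ q → IsEvent Y (E q)) → IsEvent Y (⋂ ℚ E)
    ⋂ℚ-event {E} e = ext-event
      ((λ none q → by-contradiction (λ y∉ → none (q , y∉))) , λ all (q , y∉) → y∉ (all q))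
      (compl-event (⋃ℚ-event {λ q → ∁ (E q)} (λ q → compl-event (e q))))

    ⇒-event : ∀ {P : Set} {E} → IsEvent Y E → IsEvent Y (λ y → P → E y)
    ⇒-event {P} e with em {P = P}
    ... | yes p = ext-event ((λ y∈ _ → y∈) , (λ y∈ → y∈ p)) e
    ... | no ¬p = ext-event ((λ _ p → contradiction p ¬p) , (λ _ → tt)) whole-event

  -- Elementary properties of probability measures

  module _ {Y : MeasurableSpace} (μ : Prob Y) where
    open MeasurableSpace Y using (whole-event; compl-event; union-event; ext-event)
    open Events Y

    pairᵉ : Event Y → Event Y → ℕ → Event Y
    pairᵉ (E , e) (F , f) k = pair E F k , pair-event e f k

    measure-∪-sup : ∀ E F H → proj₁ E DisjointFrom proj₁ F → proj₁ H ≐ proj₁ E ∪ proj₁ F →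
      IsSup (PartialSums (measure μ ∘ pairᵉ E F)) (measure μ H)
    measure-∪-sup E F H E⊥F H≐ =
      let ub , lub = additive μ (pairᵉ E F) (pair-disjoint E⊥F)
          same = respects μ H (unionᵉ Y (pairᵉ E F)) (≐-trans H≐ (≐-sym ⋃-pair))
      in (λ y y∈ → proj₂ same ∘ ub y y∈) , λ z bound → lub z bound ∘ proj₁ same

    -- Additivity for the sequence consisting of the whole space, E and then empty sets bounds the
    -- second partial sum, 1 + μ(E), by 1.
    measure-empty : ∀ E → Empty (proj₁ E) → measure μ E ≤ 0ℝ
    measure-empty E empty = 1+x≤1⇒x≤0 (measure μ E)
      (proj₁ (total μ) ∘
       proj₁ (measure-∪-sup (wholeᵉ Y) E (wholeᵉ Y) (λ {y} (_ , y∈E) → empty y y∈E)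
                (inj₁ , λ _ → tt)) _ (2 , refl) ∘
       +-mono 1ℝ (0ℝ + measure μ (wholeᵉ Y)) (measure μ E) (measure μ E)
         (y≤x+y 0ℝ (measure μ (wholeᵉ Y)) id ∘ proj₂ (total μ)) id)

    measure-∪ : ∀ E F H → proj₁ E DisjointFrom proj₁ F → proj₁ H ≐ proj₁ E ∪ proj₁ F →
      measure μ E + measure μ F ≃ measure μ H
    measure-∪ E F H E⊥F H≐ =
      (ub _ (2 , refl) ∘ +-mono a (0ℝ + a) b b (y≤x+y 0ℝ a id) id) ,
      lub (a + b) λ { _ (N , refl) → bound N }
      where
      a = measure μ E
      b = measure μ F
      ub  = proj₁ (measure-∪-sup E F H E⊥F H≐)
      lub = proj₂ (measure-∪-sup E F H E⊥F H≐)

      bound : ∀ N → partialSum (measure μ ∘ pairᵉ E F) N ≤ a + b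
      bound zero                = x≤x+y a b (nonneg μ F) ∘ nonneg μ E
      bound (suc zero)          = x≤x+y a b (nonneg μ F) ∘ x+y≤y 0ℝ a id
      bound (suc (suc zero))    = +-mono (0ℝ + a) a b b (x+y≤y 0ℝ a id) id
      -- From index 2 on the terms belong to the empty padding, so the sums no longer grow.
      bound (suc (suc (suc N))) = bound (suc (suc N)) ∘
        x+y≤x (partialSum (measure μ ∘ pairᵉ E F) (suc (suc N)))
          (measure μ (pairᵉ E F (suc (suc N))))
          (measure-empty (pairᵉ E F (suc (suc N))) (λ _ y∉U → y∉U tt))

    measure-compl : ∀ E → measure μ E + measure μ (complᵉ Y E) ≃ 1ℝ
    measure-compl E = ≐-trans
      (measure-∪ E (complᵉ Y E) (wholeᵉ Y) (λ (y∈ , y∉) → y∉ y∈) (either , λ _ → tt)) (total μ)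
      where
      either : U ⊆ proj₁ E ∪ ∁ (proj₁ E)
      either {y} _ with em {P = proj₁ E y}
      ... | yes y∈ = inj₁ y∈
      ... | no y∉  = inj₂ y∉

    measure-mono : ∀ E F → proj₁ E ⊆ proj₁ F → measure μ E ≤ measure μ F
    measure-mono E F E⊆F =
      proj₁ (measure-∪ E F∖E F (λ (y∈ , _ , y∉) → y∉ y∈)
        (split , λ { (inj₁ y∈E) → E⊆F y∈E ; (inj₂ (y∈F , _)) → y∈F })) ∘
      x≤x+y (measure μ E) (measure μ F∖E) (nonneg μ F∖E)
      where
      F∖E = interᵉ Y F (complᵉ Y E)

      split : proj₁ F ⊆ proj₁ E ∪ proj₁ F∖E
      split {y} y∈F with em {P = proj₁ E y}
      ... | yes y∈ = inj₁ y∈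
      ... | no y∉  = inj₂ (y∈F , y∉)

    measure-≤1 : ∀ E → measure μ E ≤ 1ℝ
    measure-≤1 E = proj₁ (total μ) ∘ measure-mono E (wholeᵉ Y) (λ _ → tt)

    measure-𝕀 : Event Y → 𝕀
    measure-𝕀 E = measure μ E , nonneg μ E , measure-≤1 E

    null-⋃ : ∀ (E : ℕ → Event Y) → (∀ k → measure μ (E k) ≤ 0ℝ) → measure μ (unionᵉ Y E) ≤ 0ℝ
    null-⋃ E null =
      proj₂ (additive μ freshᵉ (fresh-disjoint (proj₁ ∘ E))) 0ℝ (λ { _ (N , refl) →
        partialSum-≤0 (measure μ ∘ freshᵉ)
          (λ k → null k ∘ measure-mono (freshᵉ k) (E k) proj₁) N }) ∘
      proj₁ (respects μ (unionᵉ Y E) (unionᵉ Y freshᵉ) (≐-sym (⋃-fresh (proj₁ ∘ E))))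
      where
      freshᵉ : ℕ → Event Y
      freshᵉ k = fresh (proj₁ ∘ E) k , ∩-event (proj₂ (E k)) (before-event (proj₂ ∘ E) k)

    full⇒compl-null : ∀ E → 1ℝ ≤ measure μ E → measure μ (complᵉ Y E) ≤ 0ℝ
    full⇒compl-null E full =
      1+x≤1⇒x≤0 b (proj₁ (measure-compl E) ∘ +-mono 1ℝ (measure μ E) b b full id)
      where b = measure μ (complᵉ Y E)

    compl-null⇒full : ∀ E → measure μ (complᵉ Y E) ≤ 0ℝ → 1ℝ ≤ measure μ E
    compl-null⇒full E null =
      x+y≤x (measure μ E) (measure μ (complᵉ Y E)) null ∘ proj₂ (measure-compl E)

    full-⋂ : ∀ (E : ℕ → Event Y) → (∀ k → 1ℝ ≤ measure μ (E k)) →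
      1ℝ ≤ measure μ (⋂ ℕ (proj₁ ∘ E) , ⋂-event (proj₂ ∘ E))
    full-⋂ E full = compl-null⇒full ⋂E
      (null-⋃ (complᵉ Y ∘ E) (λ k → full⇒compl-null (E k) (full k)) ∘
       measure-mono (complᵉ Y ⋂E) (unionᵉ Y (complᵉ Y ∘ E)) λ y∉ → by-contradiction λ none →
         y∉ λ k → by-contradiction λ y∉k → none (k , y∉k))
      where
      ⋂E : Event Y
      ⋂E = ⋂ ℕ (proj₁ ∘ E) , ⋂-event (proj₂ ∘ E)

    -- On an empty space the whole space would be an empty event of measure 1. Excluded middle turns
    -- this into an actual point.
    prob-inhabited : Carrier Y
    prob-inhabited = by-contradiction λ empty →
      ¬1≤0 (measure-empty (wholeᵉ Y) (λ y _ → empty y) ∘ proj₂ (total μ))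

  -- Measures and kernels determined on a π-system

  -- Each of the two measures is itself an admissible threshold against which the other can be
  -- tested.
  same-thresholds : ∀ {Y Z} (μ : Prob Y) (ν : Prob Z) E F →
    (∀ (θ : 𝕀) → (proj₁ θ ≤ measure μ E → proj₁ θ ≤ measure ν F) ×
                 (proj₁ θ ≤ measure ν F → proj₁ θ ≤ measure μ E)) →
    measure μ E ≃ measure ν F
  same-thresholds μ ν E F same = proj₁ (same (measure-𝕀 μ E)) id , proj₂ (same (measure-𝕀 ν F)) id

  -- A generating π-system, kept apart from the generators by which `Z` is defined: S × T is defined
  -- by cylinders, but its π-system consists of truth sets.
  record IsBasis (Z : MeasurableSpace) (G : Pred (Pred (Carrier Z) 0ℓ) (lsuc ℓ))
         : Set (lsuc ℓ) where
    field
      events    : ∀ {E} → G E → IsEvent Z E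
      generates : ∀ {E} → IsEvent Z E → σ G E
      inter     : ∀ {E F} → G E → G F → G (E ∩ F)

    -- An event carries its proof of eventhood, and the proof assembled along the Dynkin system
    -- differs from the given one; `P-ext` absorbs the difference.
    induction : ∀ {p} (P : Event Z → Set p) →
      (∀ {E F} → proj₁ E ≐ proj₁ F → P E → P F) →
      (∀ {E} (g : G E) → P (E , events g)) →
      P (wholeᵉ Z) →
      (∀ E → P E → P (complᵉ Z E)) →
      (∀ E → (∀ {j k} → j ≢ k → proj₁ (E j) DisjointFrom proj₁ (E k)) →
        (∀ k → P (E k)) → P (unionᵉ Z E)) →
      ∀ E → P E
    induction P P-ext P-gen P-whole P-compl P-union (E , e) =
      P-ext ≐-refl (proj₂ (go (σ⊆Dynkin G inter (generates e))))
      where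
      go : ∀ {E} → Dynkin G E → Σ[ e ∈ IsEvent Z E ] P (E , e)
      go (gen g)            = events g , P-gen g
      go whole              = _ , P-whole
      go (compl e)          = _ , P-compl (_ , proj₁ (go e)) (proj₂ (go e))
      go (union disjoint e) =
        _ , P-union (λ k → _ , proj₁ (go (e k))) disjoint (λ k → proj₂ (go (e k)))
      go (ext E≐F e)        =
        MeasurableSpace.ext-event Z E≐F (proj₁ (go e)) , P-ext E≐F (proj₂ (go e))

  module _ {Z : MeasurableSpace} {G : Pred (Pred (Carrier Z) 0ℓ) (lsuc ℓ)}
    (basis : IsBasis Z G) where
    open IsBasis basis

    measures-agree : ∀ (μ ν : Prob Z) →
      (∀ {E} (g : G E) → measure μ (E , events g) ≃ measure ν (E , events g)) → μ ≈ᵖ ν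
    measures-agree μ ν agree = induction (λ E → measure μ E ≃ measure ν E)
      (λ {E} {F} E≐F same → ≐-trans (respects μ F E (≐-sym E≐F))
        (≐-trans same (respects ν E F E≐F)))
      agree
      (≐-trans (total μ) (≐-sym (total ν)))
      (λ E same →
        let a  = measure μ E
            a′ = measure μ (complᵉ Z E)
            b  = measure ν E
            b′ = measure ν (complᵉ Z E)
        in complementary-≤ b a b′ a′ (measure-compl ν E) (measure-compl μ E) (proj₂ same) ,
           complementary-≤ a b a′ b′ (measure-compl μ E) (measure-compl ν E) (proj₁ same))
      (λ E disjoint same →
        let a = measure μ (unionᵉ Z E) ; b = measure ν (unionᵉ Z E)
        in partialSums-sup-mono (measure μ ∘ E) (measure ν ∘ E) a b (λ k → proj₁ (same k))
             (additive μ E disjoint) (additive ν E disjoint) ,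
           partialSums-sup-mono (measure ν ∘ E) (measure μ ∘ E) b a (λ k → proj₂ (same k))
             (additive ν E disjoint) (additive μ E disjoint))

    -- The events E for which y ↦ κ y E is measurable form a Dynkin system.
    module _ {Y : MeasurableSpace} (κ : Func (setoid Y) (setoid (Δ Z)))
             (measurable-on-basis : ∀ {E} (g : G E) θ →
               IsEvent Y (λ y → 𝓑 θ (E , events g) (Func.to κ y))) where
      open Events Y
      open MeasurableSpace Y using (whole-event; compl-event; union-event; ext-event)
      open Func κ using (to)

      private
        IsMeasurable : (Carrier Y → ℝ) → Set (lsuc ℓ)
        IsMeasurable f = ∀ q → IsEvent Y (λ y → q ∈ Lower (f y))

        -- Addition of cuts is by definition a countable union over pairs of rationals.
        +-measurable : ∀ {f g} → IsMeasurable f → IsMeasurable g → IsMeasurable (λ y → f y + g y)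
        +-measurable f-meas g-meas q = ⋃ℚ-event λ r → ⋃ℚ-event λ s →
          ∩-event (f-meas r) (∩-event (g-meas s) (const-event (q ℚ.< r ℚ.+ s)))

        partialSum-measurable : ∀ {f : Carrier Y → ℕ → ℝ} → (∀ k → IsMeasurable (λ y → f y k)) →
          ∀ N → IsMeasurable (λ y → partialSum (f y) N)
        partialSum-measurable f-meas zero    q = const-event (q ℚ.< 0ℚ)
        partialSum-measurable {f} f-meas (suc N) =
          +-measurable {λ y → partialSum (f y) N} {λ y → f y N} (partialSum-measurable {f} f-meas N)
            (f-meas N)

      measure-measurable : ∀ E → IsMeasurable (λ y → measure (to y) E)
      measure-measurable = induction (λ E → IsMeasurable (λ y → measure (to y) E))
        (λ {E} {F} E≐F E-meas q → ext-event
          ((λ {y} → proj₁ (respects (to y) E F E≐F)) , (λ {y} → proj₂ (respects (to y) E F E≐F)))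
            (E-meas q))
        on-basis
        (λ q → ext-event ((λ {y} → proj₂ (total (to y))) , (λ {y} → proj₁ (total (to y))))
          (const-event (q ℚ.< 1ℚ)))
        -- The cut of 1 - μ(E) is the union over rational r > q of the conditions 1 - r ∉ μ(E).
        (λ E E-meas q → ext-event
          ((λ {y} (r , q<r , 1-r∉) →
             ∈-complementary (measure (to y) E) (measure (to y) (complᵉ Z E))
               (measure-compl (to y) E) q<r 1-r∉) ,
           (λ {y} → complementary-∈ (measure (to y) E) (measure (to y) (complᵉ Z E))
             (measure-compl (to y) E)))
          (⋃ℚ-event λ r → ∩-event (const-event (q ℚ.< r)) (compl-event (E-meas (1ℚ ℚ.- r)))))
        (λ E disjoint E-meas q → ext-event
          ((λ {y} (N , q∈) → proj₁ (additive (to y) E disjoint) _ (N , refl) q∈) ,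
           (λ {y} → ∈-sup (measure (to y) ∘ E) (measure (to y) (unionᵉ Z E))
             (additive (to y) E disjoint)))
          (union-event λ N → partialSum-measurable {λ y → measure (to y) ∘ E} E-meas N q))
        where
        on-basis : ∀ {E} (g : G E) → IsMeasurable (λ y → measure (to y) (E , events g))
        on-basis {E} g q = ext-event
          ((λ (r , q<r , _ , r≤) → r≤ q<r) ,
           (λ {y} → ∈⇒threshold (measure (to y) (E , events g)) (nonneg (to y) _)
             (measure-≤1 (to y) _)))
          (⋃ℚ-event λ r → ∩-event (const-event (q ℚ.< r)) (threshold r))
          where
          threshold : ∀ r → IsEvent Y
            (λ y → (0ℝ ≤ fromℚ r × fromℚ r ≤ 1ℝ) × fromℚ r ≤ measure (to y) (E , events g))
          threshold r with em {P = 0ℝ ≤ fromℚ r × fromℚ r ≤ 1ℝ}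
          ... | yes r∈𝕀 = ∩-event (const-event _) (measurable-on-basis g (fromℚ r , r∈𝕀))
          ... | no r∉𝕀  = ext-event ((λ ()) , λ (r∈𝕀 , _) → contradiction r∈𝕀 r∉𝕀) (const-event ⊥)

      -- Back from cuts to real thresholds: θ ≤ μ(E) says that every rational in the cut of θ is in
      -- that of μ(E), a countable intersection.
      kernel : Y →ₘ Δ Z
      kernel = record
        { func       = κ
        ; measurable = measurable-on-generators Y to λ (θ , E , A⊆𝓑 , 𝓑⊆A) → ext-event
            ((λ all → 𝓑⊆A (λ {q} → all q)) , (λ y∈A q → A⊆𝓑 y∈A {q}))
            (⋂ℚ-event λ q → ⇒-event (measure-measurable E q))
        }

  open _→ₘ_ using (func; to; cong; measurable; preimage)

  -- Sets of outer measure one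

  module _ {Y : MeasurableSpace} (μ : Prob Y) {a} {A : Pred (Carrier Y) a} where

    outer-one : (∀ E → A ⊆ proj₁ E → 1ℝ ≤ measure μ E) → IsOuterMeasure μ A 1ℝ
    outer-one full =
      (λ { _ (E , A⊆E , refl) → full E A⊆E }) ,
      (λ z lower → proj₁ (total μ) ∘ lower _ (wholeᵉ Y , (λ _ → tt) , refl))

    full-superset : IsOuterMeasure μ A 1ℝ → ∀ E → A ⊆ proj₁ E → 1ℝ ≤ measure μ E
    full-superset (lower , _) E A⊆E = lower _ (E , A⊆E , refl)

  -- Truth, descriptions and the added world

  module Formulae (Φ : Setoid (lsuc ℓ) (lsuc ℓ)) where
    open Language Φ

    _↭[_]_ : Formulas → Formula → Formulas → Set
    A ↭[ φ ] A′ = (φ ∈ A → φ ∈ A′) × (φ ∈ A′ → φ ∈ A)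

    module _ (M M′ : Model) (ω : Carrier (Model.Ω M)) (ω′ : Carrier (Model.Ω M′)) where
      private
        A  = Model.D M ω
        A′ = Model.D M′ ω′

      -- Formulas `B i θ φ` count as atoms and `P` is not asked to hold of their bodies, so one
      -- induction serves the propositional fragment, the fragment of one agent and the full
      -- language.
      agree : (P : Formulas) → (∀ {φ} → P (¬′ φ) → P φ) → (∀ {φ ψ} → P (φ ∧′ ψ) → P φ × P ψ) →
              (∀ p → P (prop p) → A ↭[ prop p ] A′) →
              (∀ i θ φ → P (B i θ φ) → A ↭[ B i θ φ ] A′) →
              ∀ φ → P φ → A ↭[ φ ] A′
      agree P P-¬ P-∧ props beliefs = go
        where
        go : ∀ φ → P φ → A ↭[ φ ] A′
        go (prop p)  p∈   = props p p∈
        go (¬′ φ)    ¬φ∈  = let to , from = go φ (P-¬ ¬φ∈) in (λ φ∉ → φ∉ ∘ from) , (λ φ∉ → φ∉ ∘ to)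
        go (φ ∧′ ψ)  φψ∈  = let φ∈ , ψ∈     = P-∧ φψ∈
                                to , from   = go φ φ∈
                                to′ , from′ = go ψ ψ∈
                            in (λ (a , b) → to a , to′ b) , (λ (a , b) → from a , from′ b)
        go (B i θ φ) Bφ∈  = beliefs i θ φ Bφ∈

      propositional-agree : (∀ p → A ↭[ prop p ] A′) → ∀ φ → Propositional φ → A ↭[ φ ] A′
      propositional-agree props = agree Propositional id id (λ p _ → props p) (λ _ _ _ ())

      beliefs-agree : ∀ i → (∀ θ φ → A ↭[ B i θ φ ] A′) → ∀ φ → BeliefsOf i φ → A ↭[ φ ] A′
      beliefs-agree i beliefs = agree (BeliefsOf i) id id (λ _ ()) λ { _ θ φ refl → beliefs θ φ }

      all-agree : (∀ p → A ↭[ prop p ] A′) → (∀ i θ φ → A ↭[ B i θ φ ] A′) → A ≐ A′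
      all-agree props beliefs =
        let same = agree (λ _ → ⊤) id (λ _ → tt , tt) (λ p _ → props p) (λ i θ φ _ → beliefs i θ φ)
        in (λ {φ} → proj₁ (same φ tt)) , (λ {φ} → proj₂ (same φ tt))

      -- On a fragment closed under negation inclusion forces equality: a formula false on the left
      -- has its negation there, hence also on the right.
      ⊆-agree : (P : Formulas) → (∀ {φ} → P φ → P (¬′ φ)) → A ∩ P ⊆ A′ → ∀ φ → P φ → A ↭[ φ ] A′
      ⊆-agree P P-¬ ⊆A′ φ φ∈P = (λ φ∈A → ⊆A′ (φ∈A , φ∈P)) , λ φ∈A′ →
        by-contradiction λ φ∉A → ⊆A′ {¬′ φ} (φ∉A , P-¬ φ∈P) φ∈A′

    complete⇒≐ : ∀ {A : Formulas} M ω → (∀ φ → φ ∈ A ⊎ ¬′ φ ∈ A) → A ⊆ Model.D M ω → A ≐ Model.D M ω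
    complete⇒≐ {A} M ω complete A⊆D = A⊆D , D⊆A
      where
      D⊆A : Model.D M ω ⊆ A
      D⊆A {φ} φ∈D with complete φ
      ... | inj₁ φ∈A  = φ∈A
      ... | inj₂ ¬φ∈A = contradiction φ∈D (A⊆D ¬φ∈A)

    description⇒world : ∀ {A : Formulas} → IsDescription A → Σ[ M ∈ Model ] ∃ λ ω → A ≐ Model.D M ω
    description⇒world ((M , _ , ω , A⊆D) , complete) = M , ω , complete⇒≐ M ω complete A⊆D

    D-complete : ∀ M ω φ → φ ∈ Model.D M ω ⊎ ¬′ φ ∈ Model.D M ω
    D-complete M ω φ with em {P = φ ∈ Model.D M ω}
    ... | yes φ∈ = inj₁ φ∈
    ... | no φ∉  = inj₂ φ∉

    D-description : ∀ M ω → IsDescription (Model.D M ω)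
    D-description M ω = (M , tt , ω , id) , D-complete M ω

    D-cong : ∀ M {ω ω′} → MeasurableSpace._≈_ (Model.Ω M) ω ω′ → Model.D M ω ⊆ Model.D M ω′
    D-cong M ω≈ω′ {φ} = MeasurableSpace.event-respects (Model.Ω M) (proj₂ (Model.⟦_⟧ M φ)) ω≈ω′

    -- The new world ⋆ borrows its propositions from ω₀ and the beliefs of agent i
    -- from ω i.  As no agent gives ⋆ positive probability, the beliefs stay
    -- introspective whichever worlds are combined.
    module Extension (M : Model) (ω₀ : Carrier (Model.Ω M)) (ω : Fin n → Carrier (Model.Ω M)) where
      open Model M

      -- Events are judged by their trace on `Ω`. This makes `restoreₘ` measurable by definition,
      -- wherever it sends ⋆.
      Ω⁺ : MeasurableSpace
      Ω⁺ = record
        { setoid         = Pointwise.setoid (setoid Ω)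
        ; IsEvent        = λ E → IsEvent Ω (just ⊢ E)
        ; whole-event    = whole-event
        ; compl-event    = compl-event
        ; union-event    = union-event
        ; ext-event      = λ (E⊆F , F⊆E) → ext-event (E⊆F , F⊆E)
        ; event-respects = λ { e (just x≈y) → event-respects e x≈y ; e nothing → id }
        }
        where
        open MeasurableSpace Ω
          using (whole-event; compl-event; union-event; ext-event; event-respects)

      ⋆ : Carrier Ω⁺
      ⋆ = nothing

      justₘ : Ω →ₘ Ω⁺
      justₘ = record { func = record { to = just ; cong = just } ; measurable = id }

      module _ (ν : Carrier Ω) where
        restoreₘ : Ω⁺ →ₘ Ω
        restoreₘ = record
          { func       = record
            { to   = maybe′ id ν
            ; cong = λ { (just x≈y) → x≈y ; nothing → Setoid.refl (setoid Ω) }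
            }
          ; measurable = id
          }

      M⁺ : Model
      M⁺ = record
        { Ω      = Ω⁺
        ; frame  = record
          { Pr            = Pr⁺
          ; introspective = λ i w → outer-one (to (Pr⁺ i) w) λ E ⊆E →
              full-superset (to (Pr i) (to (restoreₘ (ω i)) w))
                (introspective i (to (restoreₘ (ω i)) w)) (preimage justₘ E)
                λ same → ⊆E (λ F → same (preimage justₘ F))
          }
        ; π      = λ p → preimage (restoreₘ ω₀) (π p)
        ; π-cong = λ p≈q → let p⊆q , q⊆p = π-cong p≈q in p⊆q , q⊆p
        }
        where
        Pr⁺ : ∀ i → Ω⁺ →ₘ Δ Ω⁺
        Pr⁺ i = pushforwardₘ justₘ ∘ₘ Pr i ∘ₘ restoreₘ (ω i)

      just-truth : ∀ φ → just ⊢ proj₁ (Model.⟦_⟧ M⁺ φ) ≐ proj₁ ⟦ φ ⟧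
      B-truth : ∀ i θ φ ν → let p = measure (to (Pr i) ν) (preimage justₘ (Model.⟦_⟧ M⁺ φ)) in
        (proj₁ θ ≤ p → B i θ φ ∈ D ν) × (B i θ φ ∈ D ν → proj₁ θ ≤ p)

      just-truth (prop p)  = id , id
      just-truth (¬′ φ)    = let t , f = just-truth φ in (λ ∉ → ∉ ∘ f) , (λ ∉ → ∉ ∘ t)
      just-truth (φ ∧′ ψ)  = let t , f = just-truth φ ; t′ , f′ = just-truth ψ
                             in (λ (a , b) → t a , t′ b) , (λ (a , b) → f a , f′ b)
      just-truth (B i θ φ) = (λ {ν} → proj₁ (B-truth i θ φ ν)) , (λ {ν} → proj₂ (B-truth i θ φ ν))

      B-truth i θ φ ν =
        let p , q = respects (to (Pr i) ν) (preimage justₘ (Model.⟦_⟧ M⁺ φ)) ⟦ φ ⟧ (just-truth φ)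
        in (λ θ≤ → p ∘ θ≤) , (λ θ≤ → q ∘ θ≤)

      ⋆-prop : d₀ M ω₀ ⊆ Model.D M⁺ ⋆
      ⋆-prop {φ} (φ∈ , φ-prop) = proj₁ (propositional-agree M M⁺ ω₀ ⋆ (λ p → id , id) φ φ-prop) φ∈

      ⋆-beliefs : ∀ i → d M i (ω i) ⊆ Model.D M⁺ ⋆
      ⋆-beliefs i {φ} (φ∈ , φ-i) = proj₁ (beliefs-agree M M⁺ (ω i) ⋆ i
        (λ θ φ → proj₂ (B-truth i θ φ (ω i)) , proj₁ (B-truth i θ φ (ω i))) φ φ-i) φ∈

    -- Descriptions of the points of S × T

    module DescriptionOf (M : Model) where

      -- The predicate of `desc-spec`, named so that the results below cover both the constructed
      -- `desc` and that of an arbitrary `TypeSpaceOf`.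
      IsJoint : Carrier (States M ⊗ Types M) → Formulas → Set (lsuc (lsuc ℓ))
      IsJoint (x , t) A = IsDescription A × proj₁ x ⊆ A × (∀ i → proj₁ (t i) ⊆ A)

      -- A state already decides every propositional formula, so a description that includes it can
      -- add none.
      joint-propositional : ∀ x t {A} → IsJoint (x , t) A → ∀ φ → Propositional φ → proj₁ x ↭[ φ ] A
      joint-propositional (_ , ω₀ , x⊆ , ⊆x) t (A-desc , x⊆A , _) φ φ-prop =
        let N , ν , A⊆D , D⊆A = description⇒world A-desc
            p , q = ⊆-agree M N ω₀ ν Propositional id
              (λ {ψ} ψ∈ → A⊆D {ψ} (x⊆A {ψ} (⊆x {ψ} ψ∈))) φ φ-prop
        in (λ φ∈x → x⊆A φ∈x) , (λ φ∈A → ⊆x {φ} (q (A⊆D {φ} φ∈A) , φ-prop))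

      joint-beliefs : ∀ x t {A} → IsJoint (x , t) A → ∀ i φ → BeliefsOf i φ → proj₁ (t i) ↭[ φ ] A
      joint-beliefs x t (A-desc , _ , t⊆A) i φ φ-i =
        let _ , ω , _ , ⊆t = t i
            N , ν , A⊆D , D⊆A = description⇒world A-desc
            p , q = ⊆-agree M N ω ν (BeliefsOf i) id
              (λ {ψ} ψ∈ → A⊆D {ψ} (t⊆A i {ψ} (⊆t {ψ} ψ∈))) φ φ-i
        in (λ φ∈t → t⊆A i φ∈t) , (λ φ∈A → ⊆t {φ} (q (A⊆D {φ} φ∈A) , φ-i))

      -- Descriptions are sets of formulas true at a world, hence fixed by the formulas `prop p` and
      -- `B i θ φ`, each of which is decided by one of the components.
      joint-unique : ∀ x t {A A′} → IsJoint (x , t) A → IsJoint (x , t) A′ → A ≐ A′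
      joint-unique x t {A} {A′} A-joint A′-joint =
        let N , ν , A≐D   = description⇒world (proj₁ A-joint)
            N′ , ν′ , A′≐D = description⇒world (proj₁ A′-joint)
        in ≐-trans A≐D (≐-trans
             (all-agree N N′ ν ν′
               (λ p → through {x = proj₁ x} {φ = prop p} A≐D A′≐D
                 (joint-propositional x t A-joint (prop p) tt)
                 (joint-propositional x t A′-joint (prop p) tt))
               (λ i θ φ → through {x = proj₁ (t i)} {φ = B i θ φ} A≐D A′≐D
                 (joint-beliefs x t A-joint i (B i θ φ) refl)
                 (joint-beliefs x t A′-joint i (B i θ φ) refl)))
             (≐-sym A′≐D))
        where
        through : ∀ {x D D′ φ} → A ≐ D → A′ ≐ D′ → x ↭[ φ ] A → x ↭[ φ ] A′ → D ↭[ φ ] D′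
        through (A⊆D , D⊆A) (A′⊆D′ , D′⊆A′) (x⊆A , A⊆x) (x⊆A′ , A′⊆x) =
          (λ φ∈ → A′⊆D′ (x⊆A′ (A⊆x (D⊆A φ∈)))) , (λ φ∈ → A⊆D (x⊆A (A′⊆x (D′⊆A′ φ∈))))

      joint-respects : ∀ {xt yu A} → Setoid._≈_ (productSetoid (States M) (Types M)) xt yu →
        IsJoint xt A → IsJoint yu A
      joint-respects ((_ , y⊆x) , t≐u) (A-desc , x⊆A , t⊆A) =
        A-desc , (λ φ∈y → x⊆A (y⊆x φ∈y)) , (λ i φ∈u → t⊆A i (proj₂ (t≐u i) φ∈u))

      stateₘ : Model.Ω M →ₘ States M
      stateₘ = record
        { func       = record
          { to   = λ ω → d₀ M ω , ω , ≐-refl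
          ; cong = λ ω≈ω′ →
              (λ {φ} (φ∈ , P) → D-cong M ω≈ω′ {φ} φ∈ , P) ,
              (λ {φ} (φ∈ , P) → D-cong M (Setoid.sym (setoid (Model.Ω M)) ω≈ω′) {φ} φ∈ , P)
          }
        ; measurable = measurable-on-generators (Model.Ω M) _ λ (φ , E⊆ , ⊆E) →
            ext-event ((λ φ∈ → ⊆E φ∈) , (λ φ∈ → E⊆ φ∈))
              (∩-event (proj₂ (Model.⟦_⟧ M φ)) (const-event (Propositional φ)))
        }
        where
        open Events (Model.Ω M)
        open MeasurableSpace (Model.Ω M) using (ext-event)

      typeₘ : ∀ i → Model.Ω M →ₘ Types M i
      typeₘ i = record
        { func       = record
          { to   = λ ω → d M i ω , ω , ≐-refl
          ; cong = λ ω≈ω′ →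
              (λ {φ} (φ∈ , P) → D-cong M ω≈ω′ {φ} φ∈ , P) ,
              (λ {φ} (φ∈ , P) → D-cong M (Setoid.sym (setoid (Model.Ω M)) ω≈ω′) {φ} φ∈ , P)
          }
        ; measurable = measurable-on-generators (Model.Ω M) _ λ (φ , E⊆ , ⊆E) →
            ext-event ((λ φ∈ → ⊆E φ∈) , (λ φ∈ → E⊆ φ∈))
              (∩-event (proj₂ (Model.⟦_⟧ M φ)) (const-event (BeliefsOf i φ)))
        }
        where
        open Events (Model.Ω M)
        open MeasurableSpace (Model.Ω M) using (ext-event)

    ⊗-pair : ∀ {Y X : MeasurableSpace} {T : Fin n → MeasurableSpace} → (Y →ₘ X) → (∀ i → Y →ₘ T i) →
      Y →ₘ (X ⊗ T)
    ⊗-pair {Y} f g = record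
      { func       = record
        { to   = λ y → to f y , λ i → to (g i) y
        ; cong = λ y≈z → cong f y≈z , λ i → cong (g i) y≈z
        }
      ; measurable = measurable-on-generators Y _ λ where
          (state a)  → measurable f a
          (type i b) → measurable (g i) b
      }

    -- The type space of a model

    module TypeSpaceConstruction (M : Model) where
      open Model M
      open DescriptionOf M

      S⊗T : MeasurableSpace
      S⊗T = States M ⊗ Types M

      -- Each component carries a world that witnesses it, and these witnesses are the worlds
      -- combined in ⋆. By `joint-unique` the result does not depend on them.
      desc : Carrier S⊗T → Formulas
      desc ((_ , ω₀ , _) , t) = Model.D M⁺ ⋆
        where open Extension M ω₀ (λ i → proj₁ (proj₂ (t i)))

      desc-joint : ∀ xt → IsJoint xt (desc xt)
      desc-joint ((_ , ω₀ , x⊆ , _) , t) =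
        D-description M⁺ ⋆ ,
        (λ {φ} φ∈x → ⋆-prop {φ} (x⊆ φ∈x)) ,
        λ i {φ} φ∈t → ⋆-beliefs i {φ} (proj₁ (proj₂ (proj₂ (t i))) φ∈t)
        where open Extension M ω₀ (λ i → proj₁ (proj₂ (t i)))

      desc-respects : ∀ {xt yu} → Setoid._≈_ (productSetoid (States M) (Types M)) xt yu →
        desc xt ⊆ desc yu
      desc-respects {xt} {yu} eq {φ} =
        proj₁ (joint-unique (proj₁ yu) (proj₂ yu) (joint-respects {xt} {yu} eq (desc-joint xt))
          (desc-joint yu)) {φ}

      [_] : Formula → Pred (Carrier S⊗T) 0ℓ
      [ φ ] xt = φ ∈ desc xt

      propositional-event : ∀ {φ} → Propositional φ → IsEvent S⊗T [ φ ]
      propositional-event {φ} φ-prop = ext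
        ((λ {(x , t)} → proj₁ (joint-propositional x t (desc-joint (x , t)) φ φ-prop)) ,
         (λ {(x , t)} → proj₂ (joint-propositional x t (desc-joint (x , t)) φ φ-prop)))
        (gen (state (gen (φ , ≐-refl))))

      belief-event : ∀ {i φ} → BeliefsOf i φ → IsEvent S⊗T [ φ ]
      belief-event {i} {φ} φ-i = ext
        ((λ {(x , t)} → proj₁ (joint-beliefs x t (desc-joint (x , t)) i φ φ-i)) ,
         (λ {(x , t)} → proj₂ (joint-beliefs x t (desc-joint (x , t)) i φ φ-i)))
        (gen (type i (gen (φ , ≐-refl))))

      -- Because `desc` is truth at a world of a model, `[_]` commutes with the connectives by
      -- definition, and only the atoms refer to the components.
      []-event : ∀ φ → IsEvent S⊗T [ φ ]
      []-event (prop p)  = propositional-event {prop p} tt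
      []-event (¬′ φ)    = compl ([]-event φ)
      []-event (φ ∧′ ψ)  = Events.∩-event S⊗T ([]-event φ) ([]-event ψ)
      []-event (B i θ φ) = belief-event {i} {B i θ φ} refl

      basic : Pred (Pred (Carrier S⊗T) 0ℓ) (lsuc ℓ)
      basic E = ∃ λ φ → E ≐ [ φ ]

      -- An auxiliary space with σ-algebra `σ basic`: the field `generates` below says that the
      -- identity from it to S × T is measurable.
      basic-space : MeasurableSpace
      basic-space = generate (productSetoid (States M) (Types M)) basic
        λ (φ , E⊆ , ⊆E) {xt} {yu} xt≈yu xt∈E → ⊆E (desc-respects {xt} {yu} xt≈yu {φ} (E⊆ xt∈E))

      -- A generator of a factor comes from a formula. If the formula lies in the fragment of that
      -- factor, the cylinder is its truth set; otherwise the cylinder is empty.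
      basis : IsBasis S⊗T basic
      basis = record
        { events    = λ (φ , E≐) → ext (≐-sym E≐) ([]-event φ)
        ; generates = measurable-on-generators basic-space id λ where
            (state a)  → measurable-on-generators basic-space proj₁ state-generator a
            (type i b) → measurable-on-generators basic-space (λ (_ , t) → t i) (type-generator i) b
        ; inter     = λ (φ , E⊆ , ⊆E) (ψ , F⊆ , ⊆F) →
            φ ∧′ ψ , (λ (a , b) → E⊆ a , F⊆ b) , (λ (a , b) → ⊆E a , ⊆F b)
        }
        where
        empty : ∀ {E : Pred (Carrier S⊗T) 0ℓ} → Empty E → IsEvent basic-space E
        empty none = ext
          ((λ {xt} ∉U → contradiction tt ∉U) , λ {xt} xt∈E → contradiction xt∈E (none xt))
          (compl whole)

        state-generator : ∀ {E : Pred (Carrier (States M)) 0ℓ} → (∃ λ φ → E ≐ (λ x → φ ∈ proj₁ x)) →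
          IsEvent basic-space (proj₁ ⊢ E)
        state-generator (φ , E⊆ , ⊆E) with em {P = Propositional φ}
        ... | yes φ-prop = gen (φ ,
                (λ {(x , t)} x∈E → proj₁ (joint-propositional x t (desc-joint (x , t)) φ φ-prop)
                  (E⊆ x∈E)) ,
                (λ {(x , t)} φ∈ → ⊆E
                  (proj₂ (joint-propositional x t (desc-joint (x , t)) φ φ-prop) φ∈)))
        ... | no ¬prop = empty λ ((_ , _ , x⊆ , _) , _) x∈E → ¬prop (proj₂ (x⊆ (E⊆ x∈E)))

        type-generator : ∀ i {E : Pred (Carrier (Types M i)) 0ℓ} →
          (∃ λ φ → E ≐ (λ t → φ ∈ proj₁ t)) → IsEvent basic-space ((λ (_ , t) → t i) ⊢ E)
        type-generator i (φ , E⊆ , ⊆E) with em {P = BeliefsOf i φ}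
        ... | yes φ-i = gen (φ ,
                (λ {(x , t)} t∈E → proj₁ (joint-beliefs x t (desc-joint (x , t)) i φ φ-i)
                  (E⊆ t∈E)) ,
                (λ {(x , t)} φ∈ → ⊆E (proj₂ (joint-beliefs x t (desc-joint (x , t)) i φ φ-i) φ∈)))
        ... | no ¬beliefs =
          empty λ (_ , t) t∈E → ¬beliefs (proj₂ (proj₁ (proj₂ (proj₂ (t i))) (E⊆ t∈E)))

      embed : Ω →ₘ S⊗T
      embed = ⊗-pair stateₘ typeₘ

      desc-embed : ∀ ω → desc (to embed ω) ≐ D ω
      desc-embed ω = joint-unique (proj₁ (to embed ω)) (proj₂ (to embed ω))
        (desc-joint (to embed ω)) (D-description M ω , proj₁ , λ _ → proj₁)

      β-to : ∀ i → Carrier (Types M i) → Prob S⊗T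
      β-to i (_ , ω , _) = pushforward embed (to (Pr i) ω)

      β-threshold : ∀ i t φ θ → (proj₁ θ ≤ measure (β-to i t) ([ φ ] , []-event φ)) ⇔
        B i θ φ ∈ proj₁ t
      β-threshold i (t , ω , t⊆ , ⊆t) φ θ = mk⇔ t-believes believes-t
        where
        same = respects (to (Pr i) ω) (preimage embed ([ φ ] , []-event φ)) ⟦ φ ⟧
          ((λ {ω′} → proj₁ (desc-embed ω′) {φ}) , (λ {ω′} → proj₂ (desc-embed ω′) {φ}))

        t-believes : proj₁ θ ≤ measure (to (Pr i) ω) (preimage embed ([ φ ] , []-event φ)) →
          B i θ φ ∈ t
        t-believes θ≤ = ⊆t ((λ {q} → proj₁ same ∘ θ≤ {q}) , refl)

        believes-t : B i θ φ ∈ t →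
          proj₁ θ ≤ measure (to (Pr i) ω) (preimage embed ([ φ ] , []-event φ))
        believes-t Bφ∈t = proj₂ same ∘ proj₁ (t⊆ Bφ∈t)

      thresholds-determine : ∀ (μ ν : Prob S⊗T) →
        (∀ φ (θ : 𝕀) → let [φ] = [ φ ] , []-event φ in
          (proj₁ θ ≤ measure μ [φ] → proj₁ θ ≤ measure ν [φ]) ×
          (proj₁ θ ≤ measure ν [φ] → proj₁ θ ≤ measure μ [φ])) →
        μ ≈ᵖ ν
      thresholds-determine μ ν same = measures-agree basis μ ν λ {E} (φ , E≐) →
        let F = E , ext (≐-sym E≐) ([]-event φ)
            [φ] = [ φ ] , []-event φ
        in ≐-trans (respects μ F [φ] E≐)
             (≐-trans (same-thresholds μ ν [φ] [φ] (same φ)) (respects ν [φ] F (≐-sym E≐)))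

      -- For a truth set the condition μ([φ]) ≥ θ is the generator of the types given by `B i θ φ`;
      -- `kernel` extends measurability to all events.
      β : ∀ i → Types M i →ₘ Δ S⊗T
      β i = kernel basis (record { to = β-to i ; cong = λ {t} {u} → β-cong {t} {u} })
        λ {E} (φ , E≐) θ →
          let F = E , IsBasis.events basis (φ , E≐)
              [φ] = [ φ ] , []-event φ
          in gen (B i θ φ ,
            (λ {t} θ≤ → Equivalence.to (β-threshold i t φ θ)
              (λ {q} → proj₁ (respects (β-to i t) F [φ] E≐) {q} ∘ θ≤ {q})) ,
            (λ {t} Bφ∈t → proj₂ (respects (β-to i t) F [φ] E≐) ∘
              Equivalence.from (β-threshold i t φ θ) Bφ∈t))
        where
        β-cong : ∀ {t u} → proj₁ t ≐ proj₁ u → β-to i t ≈ᵖ β-to i u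
        β-cong {t} {u} (t⊆u , u⊆t) = thresholds-determine (β-to i t) (β-to i u) λ φ θ →
          let module t = Equivalence (β-threshold i t φ θ)
              module u = Equivalence (β-threshold i u φ θ)
          in (λ θ≤ → u.from (t⊆u (t.to (λ {q} → θ≤ {q})))) ,
             (λ θ≤ → t.from (u⊆t (u.to (λ {q} → θ≤ {q}))))

      -- Introspection becomes the Dirac marginal here: worlds with the same measure for i have the
      -- same i-type, so the preimage of an event around t includes a set of outer measure one.
      type-full : ∀ i t E → t ∈ proj₁ E →
        1ℝ ≤ measure (pushforward (projᵀ (States M) (Types M) i) (β-to i t)) E
      type-full i t@(_ , ω , t≐) E t∈E = full-superset (to (Pr i) ω) (introspective i ω)
        (preimage embed (preimage (projᵀ (States M) (Types M) i) E))
        λ {ω′} same → MeasurableSpace.event-respects (Types M i) (proj₂ E) {t} {to (typeₘ i) ω′}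
          (≐-trans t≐ (same-beliefs ω′ same)) t∈E
        where
        same-beliefs : ∀ ω′ → to (Pr i) ω′ ≈ᵖ to (Pr i) ω → d M i ω ≐ d M i ω′
        same-beliefs ω′ same =
          (λ {φ} (φ∈ , φ-i) → proj₁ (agrees φ φ-i) φ∈ , φ-i) ,
          (λ {φ} (φ∈ , φ-i) → proj₂ (agrees φ φ-i) φ∈ , φ-i)
          where
          agrees = beliefs-agree M M ω ω′ i λ θ φ →
            (λ θ≤ → proj₂ (same ⟦ φ ⟧) ∘ θ≤) , (λ θ≤ → proj₁ (same ⟦ φ ⟧) ∘ θ≤)

      type-dirac : ∀ i t → IsDirac t (pushforward (projᵀ (States M) (Types M) i) (β-to i t))
      type-dirac i t E =
        (λ t∈E → measure-≤1 marginal E , type-full i t E t∈E) ,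
        (λ t∉E → full⇒compl-null marginal ∁E (type-full i t ∁E t∉E) ∘
                   measure-mono marginal E (complᵉ (Types M i) ∁E) (λ ∈E ∉E → ∉E ∈E) ,
                 nonneg marginal E)
        where
        marginal = pushforward (projᵀ (States M) (Types M) i) (β-to i t)
        ∁E = complᵉ (Types M i) E

      typeSpaceOf : TypeSpaceOf M
      typeSpaceOf = record
        { desc       = desc
        ; desc-spec  = λ x t → desc-joint (x , t) , joint-unique x t (desc-joint (x , t))
        ; []-event   = []-event
        ; beliefMaps = record { β = β ; marginal = type-dirac }
        ; β-spec     = λ i t → β-threshold i t , λ {ν} → β-unique i t ν
        }
        where
        β-unique : ∀ i t ν →
          (∀ φ θ → (proj₁ θ ≤ measure ν ([ φ ] , []-event φ)) ⇔ B i θ φ ∈ proj₁ t) →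
          β-to i t ≈ᵖ ν
        β-unique i t ν spec = thresholds-determine (β-to i t) ν λ φ θ →
          let module t = Equivalence (β-threshold i t φ θ)
              module ν = Equivalence (spec φ θ)
          in (λ θ≤ → ν.from (t.to (λ {q} → θ≤ {q}))) , (λ θ≤ → t.from (ν.to (λ {q} → θ≤ {q})))

  -- The universal probability model

  module UniversalModelConstruction (Φ : Setoid (lsuc ℓ) (lsuc ℓ)) {c}
    (C : Pred (Language.Model Φ) c) where
    open Language Φ
    open Formulae Φ

    -- A point of `Ω̄ C` records only a truth value, from which `toWitness` recovers a model and a
    -- world. Equal points may receive different worlds; `sups-determine` makes this harmless.
    realise : (ω̄ : Carrier (Ω̄ C)) → Σ[ M ∈ Model ] (C M × ∃ λ ω → proj₁ ω̄ ≐ Model.D M ω)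
    realise (_ , small) with toWitness (lower small)
    ... | (_ , complete) , M , M∈C , ω , A⊆D = M , M∈C , ω , complete⇒≐ M ω complete A⊆D

    hat-basis : IsBasis (Ω̄ C) (λ E → ∃ λ φ → E ≐ (λ ω̄ → φ ∈ proj₁ ω̄))
    hat-basis = record
      { events    = gen
      ; generates = id
      ; inter     = λ (φ , E⊆ , ⊆E) (ψ , F⊆ , ⊆F) → φ ∧′ ψ ,
          (λ {ω̄} (a , b) → let _ , _ , _ , A⊆D , D⊆A = realise ω̄ in
            D⊆A {φ ∧′ ψ} (A⊆D (E⊆ a) , A⊆D (F⊆ b))) ,
          (λ {ω̄} φψ∈ → let _ , _ , _ , A⊆D , D⊆A = realise ω̄ ; a , b = A⊆D {φ ∧′ ψ} φψ∈ in
            ⊆E (D⊆A a) , ⊆F (D⊆A b))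
      }

    satisfied : ∀ M → C M → ∀ ω → IsDescription (Model.D M ω) × SatisfiableIn C (Model.D M ω)
    satisfied M M∈C ω = D-description M ω , M , M∈C , ω , id

    classify : ∀ M → C M → Model.Ω M →ₘ Ω̄ C
    classify M M∈C = record
      { func       = record
        { to   = λ ω → Model.D M ω , lift (fromWitness (satisfied M M∈C ω))
        ; cong = λ ω≈ω′ →
            (λ {φ} → D-cong M ω≈ω′ {φ}) ,
            (λ {φ} → D-cong M (Setoid.sym (setoid (Model.Ω M)) ω≈ω′) {φ})
        }
      ; measurable = measurable-on-generators (Model.Ω M) _ λ (φ , E⊆ , ⊆E) →
          MeasurableSpace.ext-event (Model.Ω M) ((λ φ∈ → ⊆E φ∈) , (λ φ∈ → E⊆ φ∈))
            (proj₂ (Model.⟦_⟧ M φ))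
      }

    Pr̄-to : Fin n → Carrier (Ω̄ C) → Prob (Ω̄ C)
    Pr̄-to i ω̄ = let M , M∈C , ω , _ = realise ω̄ in
      pushforward (classify M M∈C) (to (Model.Pr M i) ω)

    Pr̄-hat : ∀ i ω̄ φ → let M , _ , ω , _ = realise ω̄ in
      measure (Pr̄-to i ω̄) (hat C φ) ≃ measure (to (Model.Pr M i) ω) (Model.⟦_⟧ M φ)
    Pr̄-hat i ω̄ φ =
      let M , M∈C , ω , _ = realise ω̄
      in respects (to (Model.Pr M i) ω) (preimage (classify M M∈C) (hat C φ)) (Model.⟦_⟧ M φ)
           (id , id)

    Thresholds : Fin n → Carrier (Ω̄ C) → Formula → Pred ℝ (lsuc 0ℓ)
    Thresholds i ω̄ φ y = Σ[ θ ∈ 𝕀 ] (y ≡ proj₁ θ × B i θ φ ∈ proj₁ ω̄)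

    ∈⇒threshold-≤ : ∀ i ω̄ φ x → IsSup (Thresholds i ω̄ φ) x → ∀ θ → B i θ φ ∈ proj₁ ω̄ →
      proj₁ θ ≤ x
    ∈⇒threshold-≤ i ω̄ φ x (ub , _) θ Bφ∈ = ub _ (θ , refl , Bφ∈)

    -- The supremum is attained: at a realising world the measure of φ bounds all thresholds that
    -- occur, hence bounds x, hence θ, so θ occurs too.
    threshold-≤⇒∈ : ∀ i ω̄ φ x → IsSup (Thresholds i ω̄ φ) x → ∀ θ → proj₁ θ ≤ x →
      B i θ φ ∈ proj₁ ω̄
    threshold-≤⇒∈ i ω̄ φ x (_ , lub) θ θ≤x =
      let M , _ , ω , A⊆D , D⊆A = realise ω̄
      in D⊆A {B i θ φ} (lub (measure (to (Model.Pr M i) ω) (Model.⟦_⟧ M φ))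
           (λ { _ (θ′ , refl , Bφ∈) → A⊆D {B i θ′ φ} Bφ∈ }) ∘ θ≤x)

    Pr̄-sup : ∀ i ω̄ φ → IsSup (Thresholds i ω̄ φ) (measure (Pr̄-to i ω̄) (hat C φ))
    Pr̄-sup i ω̄ φ =
      let M , _ , ω , A⊆D , D⊆A = realise ω̄
          Pr≤ , ≤Pr = Pr̄-hat i ω̄ φ
      in (λ { _ (θ , refl , Bφ∈) → ≤Pr ∘ A⊆D {B i θ φ} Bφ∈ }) ,
         -- The measure of φ is itself a threshold that occurs, so the bound applies to it.
         (λ z bound → bound _
           (measure-𝕀 (to (Model.Pr M i) ω) (Model.⟦_⟧ M φ) , refl , D⊆A {B i _ φ} id) ∘ Pr≤)

    sups-determine : ∀ i ω̄ (μ ν : Prob (Ω̄ C)) →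
      (∀ φ → IsSup (Thresholds i ω̄ φ) (measure μ (hat C φ))) →
      (∀ φ → IsSup (Thresholds i ω̄ φ) (measure ν (hat C φ))) → μ ≈ᵖ ν
    sups-determine i ω̄ μ ν μ-sup ν-sup = measures-agree hat-basis μ ν λ {E} g@(φ , E≐) →
      ≐-trans (respects μ (E , gen g) (hat C φ) E≐)
        (≐-trans (sup-unique (measure μ (hat C φ)) (measure ν (hat C φ)) (μ-sup φ) (ν-sup φ))
          (respects ν (hat C φ) (E , gen g) (≐-sym E≐)))

    Thresholds-cong : ∀ i {ω̄ ω̄′} → proj₁ ω̄ ≐ proj₁ ω̄′ → ∀ φ x → IsSup (Thresholds i ω̄ φ) x →
      IsSup (Thresholds i ω̄′ φ) x
    Thresholds-cong i (⊆′ , ′⊆) φ x (ub , lub) =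
      (λ { _ (θ , refl , Bφ∈) → ub _ (θ , refl , ′⊆ Bφ∈) }) ,
      (λ z bound → lub z λ { _ (θ , refl , Bφ∈) → bound _ (θ , refl , ⊆′ Bφ∈) })

    Pr̄-cong : ∀ i {ω̄ ω̄′} → proj₁ ω̄ ≐ proj₁ ω̄′ → Pr̄-to i ω̄ ≈ᵖ Pr̄-to i ω̄′
    Pr̄-cong i {ω̄} {ω̄′} ω̄≐ω̄′ = sups-determine i ω̄′ (Pr̄-to i ω̄) (Pr̄-to i ω̄′)
      (λ φ → Thresholds-cong i {ω̄} {ω̄′} ω̄≐ω̄′ φ (measure (Pr̄-to i ω̄) (hat C φ))
        (Pr̄-sup i ω̄ φ)) (Pr̄-sup i ω̄′)

    -- `realise` may compute the beliefs at D(ω) in another model than `M`; both image measures have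
    -- the suprema prescribed by D(ω).
    Pr̄-classify : ∀ i M M∈C ω →
      Pr̄-to i (to (classify M M∈C) ω) ≈ᵖ pushforward (classify M M∈C) (to (Model.Pr M i) ω)
    Pr̄-classify i M M∈C ω =
      sups-determine i ω̄ (Pr̄-to i ω̄) (pushforward D̄ μ) (Pr̄-sup i ω̄) λ φ →
      let Pr≤ , ≤Pr = respects μ (preimage D̄ (hat C φ)) (Model.⟦_⟧ M φ) (id , id)
      in (λ { _ (θ , refl , Bφ∈) → ≤Pr ∘ Bφ∈ }) ,
         (λ z bound → bound _ (measure-𝕀 μ (Model.⟦_⟧ M φ) , refl , id) ∘ Pr≤)
      where
      D̄ = classify M M∈C
      ω̄ = to D̄ ω
      μ = to (Model.Pr M i) ω

    Pr̄ : Fin n → Ω̄ C →ₘ Δ (Ω̄ C)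
    Pr̄ i = kernel hat-basis
      (record { to = Pr̄-to i ; cong = λ {ω̄} {ω̄′} → Pr̄-cong i {ω̄} {ω̄′} })
      λ {E} g@(φ , E≐) θ → gen (B i θ φ ,
        (λ {ω̄} θ≤ → threshold-≤⇒∈ i ω̄ φ (measure (Pr̄-to i ω̄) (hat C φ)) (Pr̄-sup i ω̄ φ) θ
                      (λ {q} → proj₁ (respects (Pr̄-to i ω̄) (E , gen g) (hat C φ) E≐) {q} ∘
                        θ≤ {q})) ,
        (λ {ω̄} Bφ∈ → proj₂ (respects (Pr̄-to i ω̄) (E , gen g) (hat C φ) E≐) ∘
                      ∈⇒threshold-≤ i ω̄ φ (measure (Pr̄-to i ω̄) (hat C φ))
                        (Pr̄-sup i ω̄ φ) θ Bφ∈))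

    -- Worlds of the realising model with equal beliefs have descriptions with equal beliefs, so the
    -- preimage of an event around the introspection set of ω̄ includes that of the realising world.
    Pr̄-introspective : ∀ i ω̄ →
      IsOuterMeasure (to (Pr̄ i) ω̄) (λ ω̄′ → to (Pr̄ i) ω̄′ ≈ᵖ to (Pr̄ i) ω̄) 1ℝ
    Pr̄-introspective i ω̄ = outer-one (to (Pr̄ i) ω̄) λ E ⊆E →
      let M , M∈C , ω , _ = realise ω̄
      in full-superset (to (Model.Pr M i) ω) (Model.introspective M i ω)
           (preimage (classify M M∈C) E)
           λ {ω′} same → ⊆E λ F → ≐-trans (Pr̄-classify i M M∈C ω′ F)
             (same (preimage (classify M M∈C) F))

    universalModel : UniversalModel C
    universalModel = record
      { frame   = record { Pr = Pr̄ ; introspective = Pr̄-introspective }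
      ; Pr-spec = λ i ω̄ → Pr̄-sup i ω̄ ,
          λ {ν} ν-sup → sups-determine i ω̄ (Pr̄-to i ω̄) ν (Pr̄-sup i ω̄) ν-sup
      }

    module Truth (M̄ : UniversalModel C) where
      open UniversalModel M̄

      -- Connectives are settled at a realising world. Of the beliefs of `M̄` only the specified
      -- suprema enter, so this holds for every universal model.
      truth : ∀ φ → proj₁ (Model.⟦_⟧ model φ) ≐ (λ ω̄ → φ ∈ proj₁ ω̄)
      truth (prop p)  = id , id
      truth (¬′ φ)    =
        let t , f = truth φ
        in (λ {ω̄} φ∉ → let _ , _ , _ , A⊆D , D⊆A = realise ω̄ in D⊆A {¬′ φ} (φ∉ ∘ f ∘ D⊆A)) ,
           (λ {ω̄} ¬φ∈ φ∈ → let _ , _ , _ , A⊆D , _ = realise ω̄ in A⊆D {¬′ φ} ¬φ∈ (A⊆D (t φ∈)))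
      truth (φ ∧′ ψ)  =
        let t , f = truth φ ; t′ , f′ = truth ψ
        in (λ {ω̄} (a , b) → let _ , _ , _ , A⊆D , D⊆A = realise ω̄ in
             D⊆A {φ ∧′ ψ} (A⊆D (t a) , A⊆D (t′ b))) ,
           (λ {ω̄} φψ∈ → let _ , _ , _ , A⊆D , D⊆A = realise ω̄ ; a , b = A⊆D {φ ∧′ ψ} φψ∈ in
             f (D⊆A a) , f′ (D⊆A b))
      truth (B i θ φ) =
        (λ {ω̄} θ≤ → let sup = proj₁ (Pr-spec i ω̄) φ in
          threshold-≤⇒∈ i ω̄ φ (measure (to (Pr i) ω̄) (hat C φ)) sup θ
            (λ {q} → proj₁ (respects (to (Pr i) ω̄) (Model.⟦_⟧ model φ) (hat C φ) (truth φ)) {q} ∘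
              θ≤ {q})) ,
        (λ {ω̄} Bφ∈ → let sup = proj₁ (Pr-spec i ω̄) φ in
          proj₂ (respects (to (Pr i) ω̄) (Model.⟦_⟧ model φ) (hat C φ) (truth φ)) ∘
          ∈⇒threshold-≤ i ω̄ φ (measure (to (Pr i) ω̄) (hat C φ)) sup θ Bφ∈)

  -- Point masses

  indicator : Set → ℝ
  indicator P with em {P = P}
  ... | yes _ = 1ℝ
  ... | no  _ = 0ℝ

  indicator-1 : ∀ {P} → P → indicator P ≃ 1ℝ
  indicator-1 {P} p with em {P = P}
  ... | yes _ = ≐-refl
  ... | no ¬p = contradiction p ¬p

  indicator-0 : ∀ {P} → ¬ P → indicator P ≃ 0ℝ
  indicator-0 {P} ¬p with em {P = P}
  ... | yes p = contradiction p ¬p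
  ... | no _  = ≐-refl

  0≤1 : 0ℝ ≤ 1ℝ
  0≤1 = fromℚ-≤ 1ℝ (ℚₚ.positive⁻¹ 1ℚ)

  indicator-nonneg : ∀ P → 0ℝ ≤ indicator P
  indicator-nonneg P with em {P = P}
  ... | yes _ = 0≤1
  ... | no _  = id

  indicator-cong : ∀ {P Q} → (P → Q) → (Q → P) → indicator P ≃ indicator Q
  indicator-cong {P} {Q} P→Q Q→P with em {P = P}
  ... | yes p = ≐-sym (indicator-1 (P→Q p))
  ... | no ¬p = ≐-sym (indicator-0 (¬p ∘ Q→P))

  dirac : ∀ {Y} → Carrier Y → Prob Y
  dirac {Y} y = record
    { measure  = λ (E , _) → indicator (E y)
    ; respects = λ _ _ (E⊆F , F⊆E) → indicator-cong E⊆F F⊆E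
    ; nonneg   = λ (E , _) → indicator-nonneg (E y)
    ; total    = indicator-1 tt
    ; additive = λ E disjoint →
        (λ { _ (N , refl) → upper E disjoint N }) , λ z bound → least E z (λ N → bound _ (N , refl))
    }
    where
    mass : (ℕ → Event Y) → ℕ → ℝ
    mass E k = indicator (proj₁ (E k) y)

    sum-nonneg : ∀ E N → 0ℝ ≤ partialSum (mass E) N
    sum-nonneg E zero    = id
    sum-nonneg E (suc N) =
      x≤x+y (partialSum (mass E) N) (mass E N) (indicator-nonneg (proj₁ (E N) y)) ∘ sum-nonneg E N

    sum-zero : ∀ E N → (∀ {k} → k ℕ.< N → y ∉ proj₁ (E k)) → partialSum (mass E) N ≤ 0ℝ
    sum-zero E zero    y∉ = id
    sum-zero E (suc N) y∉ = sum-zero E N (λ k<N → y∉ (ℕₚ.m<n⇒m<1+n k<N)) ∘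
      x+y≤x (partialSum (mass E) N) (mass E N) (proj₁ (indicator-0 (y∉ (ℕₚ.n<1+n N))))

    upper : ∀ E → (∀ {j k} → j ≢ k → proj₁ (E j) DisjointFrom proj₁ (E k)) →
            ∀ N → partialSum (mass E) N ≤ indicator (⋃ ℕ (proj₁ ∘ E) y)
    upper E disjoint zero    = indicator-nonneg _
    upper E disjoint (suc N) with em {P = proj₁ (E N) y}
    -- By disjointness y is in none of the earlier sets, so their sum vanishes and only the last
    -- term counts.
    ... | yes y∈ = proj₂ (indicator-1 (N , y∈)) ∘
      x+y≤y (partialSum (mass E) N) 1ℝ (sum-zero E N λ k<N y∈k → disjoint (ℕₚ.<⇒≢ k<N) (y∈k , y∈))
    ... | no y∉  = upper E disjoint N ∘ x+y≤x (partialSum (mass E) N) 0ℝ id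

    least : ∀ E z → (∀ N → partialSum (mass E) N ≤ z) → indicator (⋃ ℕ (proj₁ ∘ E) y) ≤ z
    least E z bound with em {P = ⋃ ℕ (proj₁ ∘ E) y}
    ... | no _         = bound 0
    ... | yes (k , y∈) = bound (suc k) ∘
      y≤x+y (partialSum (mass E) k) (mass E k) (sum-nonneg E k) ∘ proj₂ (indicator-1 y∈)

  -- Constant maps, projections and updated profiles

  constₘ : ∀ {Y Z} → Carrier Z → Y →ₘ Z
  constₘ {Y} {Z} z = record
    { func       = record { to = λ _ → z ; cong = λ _ → Setoid.refl (setoid Z) }
    ; measurable = λ {E} _ → Events.const-event Y (E z)
    }

  projˣ : ∀ X T → (X ⊗ T) →ₘ X
  projˣ X T = record
    { func       = record { to = proj₁ ; cong = proj₁ }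
    ; measurable = λ a → gen (state a)
    }

  module _ {A : Fin n → Set (lsuc ℓ)} where
    update : (∀ j → A j) → ∀ i → A i → ∀ j → A j
    update t i a j with i ≟ j
    ... | yes refl = a
    ... | no _     = t j

    update-same : ∀ t i a → update t i a i ≡ a
    update-same t i a with i ≟ i
    ... | yes refl = refl
    ... | no i≢i   = contradiction refl i≢i

    update-other : ∀ t i a {j} → i ≢ j → update t i a j ≡ t j
    update-other t i a {j} i≢j with i ≟ j
    ... | yes i≡j = contradiction i≡j i≢j
    ... | no _    = refl

  -- Identification of the states with X

  module Singletons (X : MeasurableSpace) (generated : GeneratedBySingletons X) where
    private module X = MeasurableSpace X
    open Setoid X.setoid using () renaming (refl to ≈-refl; sym to ≈-sym; trans to ≈-trans)
    open Language X.setoid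
    open Formulae X.setoid

    singleton : X.Carrier → Event X
    singleton x = (λ y → True (em {P = y X.≈ x})) ,
                  Equivalence.from (generated _) (gen (x , toWitness , fromWitness))

    singleton-cong : ∀ {x x′} → x X.≈ x′ → proj₁ (singleton x) ≐ proj₁ (singleton x′)
    singleton-cong x≈x′ = (λ y≈x → fromWitness (≈-trans (toWitness y≈x) x≈x′)) ,
                          (λ y≈x′ → fromWitness (≈-trans (toWitness y≈x′) (≈-sym x≈x′)))

    -- It provides a partitioned model with a world at which `prop x` is true, so that every element
    -- of X arises from a state. Its beliefs are constant, which settles introspection.
    pointModel : X.Carrier → Model
    pointModel x = record
      { Ω      = X
      ; frame  = record
        { Pr            = λ _ → constₘ (dirac {X} x)
        ; introspective = λ _ _ → outer-one (dirac {X} x) λ E ⊆E →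
            proj₂ (indicator-1 (⊆E {x} λ _ → ≐-refl))
        }
      ; π      = singleton
      ; π-cong = singleton-cong
      }

    pointModel-partitioned : ∀ x → Partitioned X (pointModel x)
    pointModel-partitioned x y = y , fromWitness ≈-refl , λ y≈z → toWitness y≈z

    module _ (M̄ : UniversalModel (Partitioned X)) where
      open UniversalModel M̄ using (model)
      open UniversalModelConstruction X.setoid (Partitioned X)
      open DescriptionOf model using (stateₘ)

      unique-prop : ∀ (s : Carrier (States model)) → ∃! X._≈_ (λ x → prop x ∈ proj₁ s)
      unique-prop (A , ω̄ , A⊆ , ⊆A) =
        let M , partitioned , ω , ω̄⊆ , ⊆ω̄ = realise ω̄
            x , x∈ , x-unique = partitioned ω
        in x , ⊆A {prop x} (⊆ω̄ x∈ , tt) , λ {y} y∈ → x-unique (ω̄⊆ (proj₁ (A⊆ {prop y} y∈)))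

      prop-cong : ∀ (s : Carrier (States model)) {x y} → x X.≈ y → prop x ∈ proj₁ s →
        prop y ∈ proj₁ s
      prop-cong (_ , ω̄ , A⊆ , ⊆A) {x} {y} x≈y x∈ =
        ⊆A {prop y} (proj₁ (Model.π-cong model x≈y) {ω̄} (proj₁ (A⊆ {prop x} x∈)) , tt)

      states-agree : ∀ (s s′ : Carrier (States model)) → (∀ p → proj₁ s ↭[ prop p ] proj₁ s′) →
        proj₁ s ≐ proj₁ s′
      states-agree (A , ω , A⊆ , ⊆A) (A′ , ω′ , A′⊆ , ⊆A′) same =
        (λ {φ} φ∈ → let φ∈D , P = A⊆ φ∈ in ⊆A′ (proj₁ (agrees φ P) φ∈D , P)) ,
        (λ {φ} φ∈ → let φ∈D , P = A′⊆ φ∈ in ⊆A (proj₂ (agrees φ P) φ∈D , P))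
        where
        agrees = propositional-agree model model ω ω′ λ p →
          (λ p∈ → proj₁ (A′⊆ {prop p} (proj₁ (same p) (⊆A {prop p} (p∈ , tt))))) ,
          (λ p∈ → proj₁ (A⊆ {prop p} (proj₂ (same p) (⊆A′ {prop p} (p∈ , tt)))))

      -- Generation by singletons gives measurability: the preimage of {x} is the generator of the
      -- states given by `prop x`.
      forward : States model →ₘ X
      forward = record
        { func       = record
          { to   = λ s → proj₁ (unique-prop s)
          ; cong = λ {s} {s′} (_ , s′⊆s) →
              proj₂ (proj₂ (unique-prop s)) (s′⊆s (proj₁ (proj₂ (unique-prop s′))))
          }
        ; measurable = λ e → measurable-on-generators (States model) (λ s → proj₁ (unique-prop s))
            (λ (x , F⊆ , ⊆F) → gen (prop x ,
              (λ {s} s∈F → prop-cong s (F⊆ s∈F) (proj₁ (proj₂ (unique-prop s)))) ,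
              (λ {s} x∈s → ⊆F (proj₂ (proj₂ (unique-prop s)) x∈s))))
            (Equivalence.to (generated _) e)
        }

      point : X.Carrier → Carrier (Ω̄ (Partitioned X))
      point x = to (classify (pointModel x) (pointModel-partitioned x)) x

      backward : X →ₘ States model
      backward = record
        { func       = record
          { to   = λ x → to stateₘ (point x)
          ; cong = λ {x} {x′} x≈x′ → states-agree (to stateₘ (point x)) (to stateₘ (point x′)) λ p →
              (λ (p∈ , _) → fromWitness (≈-trans (≈-sym x≈x′) (toWitness p∈)) , tt) ,
              (λ (p∈ , _) → fromWitness (≈-trans x≈x′ (toWitness p∈)) , tt)
          }
        ; measurable = measurable-on-generators X (λ x → to stateₘ (point x)) λ (φ , E⊆ , ⊆E) →
            X.ext-event ((λ {x} x∈ → ⊆E x∈) , (λ {x} x∈ → E⊆ x∈)) (on-formula φ)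
        }
        where
        truth-event : ∀ φ → Propositional φ → X.IsEvent (λ x → φ ∈ Model.D model (point x))
        truth-event (prop y) _       = X.ext-event
          ((λ x≈y → fromWitness (toWitness x≈y)) , (λ x≈y → fromWitness (toWitness x≈y)))
          (proj₂ (singleton y))
        truth-event (¬′ φ)   P       = X.compl-event (truth-event φ P)
        truth-event (φ ∧′ ψ) (P , Q) = Events.∩-event X (truth-event φ P) (truth-event ψ Q)

        on-formula : ∀ φ → X.IsEvent (λ x → φ ∈ d₀ model (point x))
        on-formula φ with em {P = Propositional φ}
        ... | yes P = X.ext-event ((λ φ∈ → φ∈ , P) , proj₁) (truth-event φ P)
        ... | no ¬P = X.ext-event ((λ ()) , λ (_ , P) → ¬P P) (Events.const-event X ⊥)

      ι : MeasurableIso (States model) X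
      ι = record
        { forward  = forward
        ; backward = backward
        ; left     = λ s → states-agree (to backward (to forward s)) s λ p →
            (λ (p∈ , _) → prop-cong s (toWitness p∈) (proj₁ (proj₂ (unique-prop s)))) ,
            (λ p∈ → fromWitness (proj₂ (proj₂ (unique-prop s)) p∈) , tt)
        ; right    = λ x →
            proj₂ (proj₂ (unique-prop (to backward x))) {x} (fromWitness ≈-refl , tt)
        }

    universalModelTypeSpace : UniversalModelTypeSpace X
    universalModelTypeSpace = record
      { M̄       = M̄
      ; 𝒯       = TypeSpaceConstruction.typeSpaceOf (UniversalModel.model M̄)
      ; ι       = ι M̄
      ; matches = λ s → proj₂ (unique-prop M̄ s)
      }
      where M̄ = UniversalModelConstruction.universalModel X.setoid (Partitioned X)

  -- Sections of events under a Dirac marginal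

  -- A measure on X ⊗ T whose marginal on Tᵢ is δ_t does not distinguish an event
  -- from its section at tᵢ = t, although {t} need not be an event.
  module Sections (X : MeasurableSpace) (T : Fin n → MeasurableSpace)
                  (i : Fin n) (t : Carrier (T i))
                  (μ : Prob (X ⊗ T)) (marginal : IsDirac t (pushforward (projᵀ X T i) μ)) where
    private
      Y : MeasurableSpace
      Y = X ⊗ T

      fix : Carrier Y → Carrier Y
      fix (x , u) = x , update u i t

    AlmostEqualsSection : Pred (Carrier Y) 0ℓ → Set (lsuc ℓ)
    AlmostEqualsSection E = Σ[ G ∈ Event Y ] (1ℝ ≤ measure μ G ×
      (∀ {ω} → ω ∈ proj₁ G → (ω ∈ E → fix ω ∈ E) × (fix ω ∈ E → ω ∈ E)))

    everywhere : ∀ {E} → (∀ {ω} → (ω ∈ E → fix ω ∈ E) × (fix ω ∈ E → ω ∈ E)) → AlmostEqualsSection E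
    everywhere same = wholeᵉ Y , proj₂ (total μ) , λ _ → same

    type-section : ∀ j {F} → IsEvent (T j) F → AlmostEqualsSection ((λ (_ , u) → u j) ⊢ F)
    type-section j {F} f = by-agent (i ≟ j)
      where
      by-agent : Dec (i ≡ j) → AlmostEqualsSection ((λ (_ , u) → u j) ⊢ F)
      by-agent (no i≢j) = everywhere λ {(_ , u)} →
        subst F (sym (update-other u i t i≢j)) , subst F (update-other u i t i≢j)
      -- The marginal makes full whichever of F and its complement contains t; on that event
      -- membership in F is constant and agrees with that of t.
      by-agent (yes refl) with em {P = t ∈ F}
      ... | yes t∈F = preimage (projᵀ X T i) (F , f) , proj₂ (proj₁ (marginal (F , f)) t∈F) ,
              λ {(_ , u)} u∈F → (λ _ → subst F (sym (update-same u i t)) t∈F) , (λ _ → u∈F)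
      ... | no t∉F  = preimage (projᵀ X T i) ∁F , proj₂ (proj₁ (marginal ∁F) t∉F) ,
              λ {(_ , u)} u∉F → (λ u∈F → contradiction u∈F u∉F) ,
                                (λ t∈F → contradiction (subst F (update-same u i t) t∈F) t∉F)
        where ∁F = complᵉ (T i) (F , f)

    -- The induction over σ-algebras goes through because a countable union needs only countably
    -- many full events `G k`, whose intersection is full.
    almostEqualsSection : ∀ {E} → IsEvent Y E → AlmostEqualsSection E
    almostEqualsSection (gen (state _))      = everywhere (id , id)
    almostEqualsSection (gen (type j f))     = type-section j f
    almostEqualsSection whole                = everywhere (id , id)
    almostEqualsSection (compl e)            =
      let G , full , same = almostEqualsSection e
      in G , full , λ ω∈G → let p , q = same ω∈G in (λ ∉E → ∉E ∘ q) , (λ ∉E → ∉E ∘ p)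
    almostEqualsSection (union e)            =
      (⋂ ℕ (λ k → proj₁ (G k)) , Events.⋂-event Y (λ k → proj₂ (G k))) ,
      full-⋂ μ G (λ k → proj₁ (proj₂ (almostEqualsSection (e k)))) ,
      λ ω∈G → (λ (k , ω∈E) → k , proj₁ (proj₂ (proj₂ (almostEqualsSection (e k))) (ω∈G k)) ω∈E) ,
              (λ (k , ω∈E) → k , proj₂ (proj₂ (proj₂ (almostEqualsSection (e k))) (ω∈G k)) ω∈E)
      where
      G : ℕ → Event Y
      G k = proj₁ (almostEqualsSection (e k))
    almostEqualsSection (ext (E⊆F , F⊆E) e)  =
      let G , full , same = almostEqualsSection e
      in G , full , λ ω∈G → let p , q = same ω∈G in
           (λ ω∈F → E⊆F (p (F⊆E ω∈F))) , (λ ω∈F → E⊆F (q (F⊆E ω∈F)))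

    -- On the full event G membership in E is that of `fix ω`, which lies on the slice; hence G is
    -- included in E.
    slice-full : ∀ E → (∀ {ω} → proj₂ ω i ≡ t → ω ∈ proj₁ E) → 1ℝ ≤ measure μ E
    slice-full E slice⊆E =
      let G , full , same = almostEqualsSection (proj₂ E)
      in measure-mono μ G E
           (λ {(x , u)} ω∈G → proj₂ (same ω∈G) (slice⊆E {fix (x , u)} (update-same u i t))) ∘ full

  -- Existence of the morphism

  module Universality (X : MeasurableSpace) (generated : GeneratedBySingletons X)
                      (𝒰 : UniversalModelTypeSpace X) (𝒯 : TypeSpace X) where
    open Language (MeasurableSpace.setoid X)

    private
      module X = MeasurableSpace X
      module 𝒯 = TypeSpace 𝒯
      module 𝒰 = UniversalModelTypeSpace 𝒰
      module 𝒮 = TypeSpaceOf 𝒰.𝒯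
      module ι = MeasurableIso 𝒰.ι

      T : Fin n → MeasurableSpace
      T = 𝒯.T

    open Setoid X.setoid using () renaming (refl to ≈-refl; sym to ≈-sym; trans to ≈-trans)
    open Formulae X.setoid
    open Singletons X generated using (singleton; singleton-cong)
    open UniversalModelConstruction X.setoid (Partitioned X)
    open Truth 𝒰.M̄ using (truth)
    open DescriptionOf 𝒰.model

    M̄ : Model
    M̄ = 𝒰.model

    S⊗T̄ : MeasurableSpace
    S⊗T̄ = States M̄ ⊗ Types M̄

    N : Model
    N = record
      { Ω      = X ⊗ T
      ; frame  = record
        { Pr            = λ i → 𝒯.β i ∘ₘ projᵀ X T i
        -- Worlds that share the i-type share the beliefs of i, so an event around the introspection
        -- set includes the slice at that type.
        ; introspective = λ i (x , t) → outer-one (to (𝒯.β i) (t i)) λ E ⊆E →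
            Sections.slice-full X T i (t i) (to (𝒯.β i) (t i)) (𝒯.marginal i (t i)) E
              λ {(y , u)} eq → ⊆E λ F → cong (𝒯.β i) (Setoid.reflexive (setoid (T i)) eq) F
        }
      ; π      = λ x → preimage (projˣ X T) (singleton x)
      ; π-cong = λ x≈y → let p , q = singleton-cong x≈y in p , q
      }

    N-partitioned : Partitioned X N
    N-partitioned (x , _) = x , fromWitness ≈-refl , λ x≈y → toWitness x≈y

    beliefs-by-type : ∀ i (ω ω′ : Carrier (X ⊗ T)) →
      MeasurableSpace._≈_ (T i) (proj₂ ω i) (proj₂ ω′ i) →
      ∀ φ → BeliefsOf i φ → Model.D N ω ↭[ φ ] Model.D N ω′
    beliefs-by-type i ω ω′ eq = beliefs-agree N N ω ω′ i λ θ φ →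
      let p , q = cong (𝒯.β i) eq (Model.⟦_⟧ N φ) in (λ θ≤ → p ∘ θ≤) , (λ θ≤ → q ∘ θ≤)

    -- 𝒯.β i t lives on X × T, which is therefore inhabited.
    worldOf : ∀ i → Carrier (T i) → Carrier (X ⊗ T)
    worldOf i t = let x , u = prob-inhabited (to (𝒯.β i) t) in x , update u i t

    worldOf-type : ∀ i t → proj₂ (worldOf i t) i ≡ t
    worldOf-type i t = update-same (proj₂ (prob-inhabited (to (𝒯.β i) t))) i t

    typeOf : ∀ i → Carrier (T i) → Carrier (Types M̄ i)
    typeOf i t = to (typeₘ i) (to (classify N N-partitioned) (worldOf i t))

    typeOf-∈ : ∀ i t φ → φ ∈ proj₁ (typeOf i t) → φ ∈ Model.D N (worldOf i t) × BeliefsOf i φ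
    typeOf-∈ i t φ (φ∈ , P) = proj₁ (truth φ) φ∈ , P

    ∈-typeOf : ∀ i t φ → φ ∈ Model.D N (worldOf i t) → BeliefsOf i φ → φ ∈ proj₁ (typeOf i t)
    ∈-typeOf i t φ φ∈ P = proj₂ (truth φ) φ∈ , P

    typeOf-cong : ∀ i {t t′} → MeasurableSpace._≈_ (T i) t t′ →
      proj₁ (typeOf i t) ⊆ proj₁ (typeOf i t′)
    typeOf-cong i {t} {t′} t≈t′ {φ} φ∈ =
      let φ∈N , P = typeOf-∈ i t φ φ∈
      in ∈-typeOf i t′ φ (proj₁ (beliefs-by-type i (worldOf i t) (worldOf i t′) same φ P) φ∈N) P
      where
      open Setoid (setoid (T i)) using (_≈_; reflexive; trans)

      same : proj₂ (worldOf i t) i ≈ proj₂ (worldOf i t′) i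
      same = trans (reflexive (worldOf-type i t)) (trans t≈t′ (reflexive (sym (worldOf-type i t′))))

    worldOf-threshold : ∀ i t φ θ → let p = measure (to (𝒯.β i) t) (Model.⟦_⟧ N φ) in
      (B i θ φ ∈ Model.D N (worldOf i t) → proj₁ θ ≤ p) ×
      (proj₁ θ ≤ p → B i θ φ ∈ Model.D N (worldOf i t))
    worldOf-threshold i t φ θ =
      let p , q = cong (𝒯.β i) (Setoid.reflexive (setoid (T i)) (worldOf-type i t)) (Model.⟦_⟧ N φ)
      in (λ θ≤ → p ∘ θ≤) , (λ θ≤ → q ∘ θ≤)

    typeOfₘ : ∀ i → T i →ₘ Types M̄ i
    typeOfₘ i = record
      { func       = record
        { to   = typeOf i
        ; cong = λ {t} {t′} t≈t′ →
            (λ {φ} → typeOf-cong i t≈t′ {φ}) ,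
            (λ {φ} → typeOf-cong i (Setoid.sym (setoid (T i)) t≈t′) {φ})
        }
      ; measurable = measurable-on-generators (T i) (typeOf i) λ (φ , E⊆ , ⊆E) →
          ext-event ((λ φ∈ → ⊆E φ∈) , (λ φ∈ → E⊆ φ∈)) (on-formula φ)
      }
      where
      open MeasurableSpace (T i) using (ext-event; compl-event)

      truth-event : ∀ φ → BeliefsOf i φ → IsEvent (T i) (λ t → φ ∈ Model.D N (worldOf i t))
      truth-event (¬′ φ)      P       = compl-event (truth-event φ P)
      truth-event (φ ∧′ ψ)    (P , Q) = Events.∩-event (T i) (truth-event φ P) (truth-event ψ Q)
      truth-event (B .i θ φ)  refl    = ext-event
        ((λ {t} → proj₂ (worldOf-threshold i t φ θ)) , (λ {t} → proj₁ (worldOf-threshold i t φ θ)))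
        (measurable (𝒯.β i) (gen (θ , Model.⟦_⟧ N φ , ≐-refl)))

      on-formula : ∀ φ → IsEvent (T i) (λ t → φ ∈ proj₁ (typeOf i t))
      on-formula φ = by-cases em
        where
        by-cases : Dec (BeliefsOf i φ) → IsEvent (T i) (λ t → φ ∈ proj₁ (typeOf i t))
        by-cases (yes P) = ext-event
          ((λ {t} φ∈ → ∈-typeOf i t φ φ∈ P) , (λ {t} φ∈ → proj₁ (typeOf-∈ i t φ φ∈)))
            (truth-event φ P)
        by-cases (no ¬P) = ext-event ((λ ()) , λ (_ , P) → ¬P P) (Events.const-event (T i) ⊥)

    describeₘ : (X ⊗ T) →ₘ S⊗T̄
    describeₘ = ⊗-pair (ι.backward ∘ₘ projˣ X T) (λ i → typeOfₘ i ∘ₘ projᵀ X T i)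

    backward-prop : ∀ x y → prop y ∈ proj₁ (to ι.backward x) → x X.≈ y
    backward-prop x y y∈ = ≈-trans (≈-sym (ι.right x)) (proj₂ (𝒰.matches (to ι.backward x)) y∈)

    prop-backward : ∀ x y → x X.≈ y → prop y ∈ proj₁ (to ι.backward x)
    prop-backward x y x≈y =
      let s = to ι.backward x
          _ , ω̄ , s⊆ , ⊆s = s
      in ⊆s {prop y} (proj₁ (Model.π-cong M̄ (≈-trans (ι.right x) x≈y)) {ω̄}
           (proj₁ (s⊆ (proj₁ (𝒰.matches s)))) , tt)

    backward-propositional : ∀ ω φ → φ ∈ proj₁ (to ι.backward (proj₁ ω)) → φ ∈ Model.D N ω
    backward-propositional ω@(x , _) φ φ∈ =
      let _ , ω̄ , s⊆ , ⊆s = to ι.backward x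
          φ∈D , P = s⊆ φ∈
      in proj₁ (propositional-agree M̄ N ω̄ ω (λ p →
           (λ p∈ → fromWitness (backward-prop x p (⊆s {prop p} (p∈ , tt)))) ,
           (λ x≈p → proj₁ (s⊆ (prop-backward x p (toWitness x≈p))))) φ P) φ∈D

    desc-joint : ∀ xt → IsJoint xt (𝒮.desc xt)
    desc-joint (x , t) = proj₁ (𝒮.desc-spec x t)

    desc-respects : ∀ xt yu → Setoid._≈_ (productSetoid (States M̄) (Types M̄)) xt yu →
      𝒮.desc xt ≐ 𝒮.desc yu
    desc-respects xt yu eq =
      joint-unique (proj₁ yu) (proj₂ yu) (joint-respects {xt} {yu} eq (desc-joint xt))
        (desc-joint yu)

    -- Uniqueness of `desc` applies: D(ω) in `N` includes the propositions of the state and, as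
    -- i-beliefs depend on the i-type only, each type computed at `worldOf`.
    desc-describe : ∀ ω → 𝒮.desc (to describeₘ ω) ≐ Model.D N ω
    desc-describe ω@(x , t) = proj₂ (𝒮.desc-spec (proj₁ (to describeₘ ω)) (proj₂ (to describeₘ ω)))
      (D-description N ω , (λ {φ} → backward-propositional ω φ) , λ i {φ} φ∈ →
        let φ∈N , P = typeOf-∈ i (t i) φ φ∈
        in proj₁ (beliefs-by-type i (worldOf i (t i)) ω
             (Setoid.reflexive (setoid (T i)) (worldOf-type i (t i))) φ P) φ∈N)

    [_]ᵉ : Formula → Event S⊗T̄
    [ φ ]ᵉ = 𝒮.[ φ ] , 𝒮.[]-event φ

    describe-truth : ∀ φ → proj₁ (preimage describeₘ [ φ ]ᵉ) ≐ proj₁ (Model.⟦_⟧ N φ)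
    describe-truth φ = (λ {ω} → proj₁ (desc-describe ω) {φ}) , (λ {ω} → proj₂ (desc-describe ω) {φ})

    β̄ : ∀ i → Types M̄ i →ₘ Δ S⊗T̄
    β̄ = BeliefMaps.β 𝒮.beliefMaps

    -- The image measure meets the threshold conditions that characterise the beliefs at
    -- `typeOf i t`, because `[ φ ]ᵉ` pulls back to the truth set of φ in `N`.
    β̄-typeOf : ∀ i t → to (β̄ i) (typeOf i t) ≈ᵖ pushforward describeₘ (to (𝒯.β i) t)
    β̄-typeOf i t = proj₂ (𝒮.β-spec i (typeOf i t)) {pushforward describeₘ (to (𝒯.β i) t)}
      λ φ θ → mk⇔ (believes φ θ) (believed φ θ)
      where
      module _ (φ : Formula) (θ : 𝕀) where
        same : measure (to (𝒯.β i) t) (preimage describeₘ [ φ ]ᵉ) ≃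
               measure (to (𝒯.β i) t) (Model.⟦_⟧ N φ)
        same = respects (to (𝒯.β i) t) (preimage describeₘ [ φ ]ᵉ) (Model.⟦_⟧ N φ)
          (describe-truth φ)

        believes : proj₁ θ ≤ measure (to (𝒯.β i) t) (preimage describeₘ [ φ ]ᵉ) →
          B i θ φ ∈ proj₁ (typeOf i t)
        believes θ≤ = ∈-typeOf i t (B i θ φ)
          (proj₂ (worldOf-threshold i t φ θ) (λ {q} → proj₁ same {q} ∘ θ≤ {q})) refl

        believed : B i θ φ ∈ proj₁ (typeOf i t) →
          proj₁ θ ≤ measure (to (𝒯.β i) t) (preimage describeₘ [ φ ]ᵉ)
        believed Bφ∈ =
          proj₂ same ∘ proj₁ (worldOf-threshold i t φ θ) (proj₁ (typeOf-∈ i t (B i θ φ) Bφ∈))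

    morphism : TypeFunctions 𝒯 𝒰.typeSpace
    morphism i = func (typeOfₘ i)

    jointₘ : (X ⊗ T) →ₘ (X ⊗ Types M̄)
    jointₘ = ⊗-pair (projˣ X T) (λ i → typeOfₘ i ∘ₘ projᵀ X T i)

    forward-id : S⊗T̄ →ₘ (X ⊗ Types M̄)
    forward-id = ⊗-pair (ι.forward ∘ₘ projˣ (States M̄) (Types M̄)) (projᵀ (States M̄) (Types M̄))

    backward-id : (X ⊗ Types M̄) →ₘ S⊗T̄
    backward-id = ⊗-pair (ι.backward ∘ₘ projˣ X (Types M̄)) (projᵀ X (Types M̄))

    -- The underlying sets coincide; only the proofs that the preimage is an event differ.
    relabel-measure : ∀ i t̄ (E : Event (X ⊗ Types M̄)) →
      measure (to (TypeSpace.β 𝒰.typeSpace i) t̄) E ≃ measure (to (β̄ i) t̄) (preimage forward-id E)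
    relabel-measure i t̄ E = respects (to (β̄ i) t̄) _ (preimage forward-id E) ≐-refl

    isTypeMorphism : IsTypeMorphism 𝒯 𝒰.typeSpace morphism
    isTypeMorphism = measurable jointₘ , λ i t E e →
      ≐-trans (relabel-measure i (typeOf i t) (E , e))
        (≐-trans (β̄-typeOf i t (preimage forward-id (E , e)))
          (respects (to (𝒯.β i) t) (preimage describeₘ (preimage forward-id (E , e)))
            (preimage jointₘ (E , e))
            -- Sending a state backward and forward again returns it only up to `≈`, which events
            -- respect.
            ((λ {(x , u)} → MeasurableSpace.event-respects (X ⊗ Types M̄) e
                (ι.right x , λ j → Setoid.refl (setoid (Types M̄ j)) {typeOf j (u j)})) ,
             (λ {(x , u)} → MeasurableSpace.event-respects (X ⊗ Types M̄) e
                (≈-sym (ι.right x) , λ j → Setoid.refl (setoid (Types M̄ j)) {typeOf j (u j)})))))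

    -- Uniqueness of the morphism

    module _ (h : TypeFunctions 𝒯 𝒰.typeSpace) (h-morphism : IsTypeMorphism 𝒯 𝒰.typeSpace h) where

      describe : Carrier (X ⊗ T) → Carrier S⊗T̄
      describe (x , t) = to ι.backward x , λ i → Func.to (h i) (t i)

      [_]ˣ : Formula → Event (X ⊗ Types M̄)
      [ φ ]ˣ = preimage backward-id [ φ ]ᵉ

      unlabel : ∀ i t̄ φ → measure (to (β̄ i) t̄) (preimage forward-id [ φ ]ˣ) ≃
        measure (to (β̄ i) t̄) [ φ ]ᵉ
      unlabel i t̄ φ = respects (to (β̄ i) t̄) (preimage forward-id [ φ ]ˣ) [ φ ]ᵉ
        ((λ {(s , u)} → proj₁ (same s u) {φ}) , (λ {(s , u)} → proj₂ (same s u) {φ}))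
        where
        same : ∀ s u → 𝒮.desc (to ι.backward (to ι.forward s) , u) ≐ 𝒮.desc (s , u)
        same s u = desc-respects _ (s , u) (ι.left s , λ j → ≐-refl)

      world : ∀ ω → Σ[ M ∈ Model ] ∃ λ ν → 𝒮.desc (describe ω) ≐ Model.D M ν
      world ω = description⇒world (proj₁ (desc-joint (describe ω)))

      describes : ∀ φ → (λ ω → φ ∈ 𝒮.desc (describe ω)) ≐ proj₁ (Model.⟦_⟧ N φ)
      describes (prop p)  =
        (λ {(x , t)} p∈ → fromWitness
          (backward-prop x p (proj₂ (joint-prop (describe (x , t))) p∈))) ,
        (λ {(x , t)} x≈p → proj₁ (joint-prop (describe (x , t)))
          (prop-backward x p (toWitness x≈p)))
        where
        joint-prop : ∀ xt → proj₁ (proj₁ xt) ↭[ prop p ] 𝒮.desc xt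
        joint-prop (x , t) = joint-propositional x t (desc-joint (x , t)) (prop p) tt
      describes (¬′ φ)    =
        let p , q = describes φ
        in (λ {ω} ¬φ∈ φ∈ → let _ , _ , A⊆ , _ = world ω in A⊆ {¬′ φ} ¬φ∈ (A⊆ (q φ∈))) ,
           (λ {ω} φ∉ → let _ , _ , _ , ⊆A = world ω in ⊆A {¬′ φ} (λ φ∈ → φ∉ (p (⊆A φ∈))))
      describes (φ ∧′ ψ)  =
        let p , q = describes φ ; p′ , q′ = describes ψ
        in (λ {ω} φψ∈ → let _ , _ , A⊆ , ⊆A = world ω ; a , b = A⊆ {φ ∧′ ψ} φψ∈ in
             p (⊆A a) , p′ (⊆A b)) ,
           (λ {ω} (a , b) → let _ , _ , A⊆ , ⊆A = world ω in ⊆A {φ ∧′ ψ} (A⊆ (q a) , A⊆ (q′ b)))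
      describes (B i θ φ) =
        (λ {ω} Bφ∈ → proj₁ (same ω) ∘ Equivalence.from (spec ω)
          (proj₂ (joint-B (describe ω)) Bφ∈)) ,
        (λ {ω} θ≤ → proj₁ (joint-B (describe ω))
          (Equivalence.to (spec ω) (λ {q} → proj₂ (same ω) {q} ∘ θ≤ {q})))
        where
        joint-B : ∀ xt → proj₁ (proj₂ xt i) ↭[ B i θ φ ] 𝒮.desc xt
        joint-B (x , t) = joint-beliefs x t (desc-joint (x , t)) i (B i θ φ) refl

        t̄ : Carrier (X ⊗ T) → Carrier (Types M̄ i)
        t̄ ω = Func.to (h i) (proj₂ ω i)

        spec : ∀ ω → (proj₁ θ ≤ measure (to (β̄ i) (t̄ ω)) [ φ ]ᵉ) ⇔ B i θ φ ∈ proj₁ (t̄ ω)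
        spec ω = proj₁ (𝒮.β-spec i (t̄ ω)) φ θ

        same : ∀ ω → measure (to (β̄ i) (t̄ ω)) [ φ ]ᵉ ≃
               measure (to (𝒯.β i) (proj₂ ω i)) (Model.⟦_⟧ N φ)
        -- The morphism equation moves the measure to X × T, where by the induction hypothesis the
        -- preimage of `[ φ ]ˣ` is the truth set of φ.
        same ω =
          ≐-trans (≐-sym (unlabel i (t̄ ω) φ))
            (≐-trans (≐-sym (relabel-measure i (t̄ ω) [ φ ]ˣ))
              (≐-trans (proj₂ h-morphism i (proj₂ ω i) (proj₁ [ φ ]ˣ) (proj₂ [ φ ]ˣ))
                (respects (to (𝒯.β i) (proj₂ ω i)) (_ , proj₁ h-morphism (proj₂ [ φ ]ˣ))
                  (Model.⟦_⟧ N φ) (describes φ))))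

      -- A type is its set of belief formulas, and at a world of type t those of `h i t` are the
      -- i-beliefs in the description of the image, which `describes` computes in `N` without
      -- reference to h.
      morphism-unique : _≈ᶠ_ 𝒯 𝒰.typeSpace morphism h
      morphism-unique i t =
        (λ {φ} φ∈ → let φ∈N , P = typeOf-∈ i t φ φ∈
                    in subst (λ u → φ ∈ proj₁ (Func.to (h i) u)) (worldOf-type i t)
                         (proj₂ (joint-h φ P) (proj₂ (describes φ) φ∈N))) ,
        (λ {φ} φ∈ → let P = proj₂ (proj₁ (proj₂ (proj₂ (Func.to (h i) t))) φ∈)
                    in ∈-typeOf i t φ (proj₁ (describes φ) (proj₁ (joint-h φ P)
                         (subst (λ u → φ ∈ proj₁ (Func.to (h i) u))
                           (sym (worldOf-type i t)) φ∈))) P)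
        where
        joint-h : ∀ φ → BeliefsOf i φ →
          proj₁ (Func.to (h i) (proj₂ (worldOf i t) i)) ↭[ φ ] 𝒮.desc (describe (worldOf i t))
        joint-h = joint-beliefs (proj₁ (describe (worldOf i t))) (proj₂ (describe (worldOf i t)))
          (desc-joint (describe (worldOf i t))) i

  universal : ∀ X → GeneratedBySingletons X → (𝒰 : UniversalModelTypeSpace X) →
    IsUniversal (UniversalModelTypeSpace.typeSpace 𝒰)
  universal X generated 𝒰 𝒯 =
    morphism , isTypeMorphism , λ {h} h-morphism → morphism-unique h h-morphism
    where open Universality X generated 𝒰 𝒯

theorem9 : (em : ∀ {a} → ExcludedMiddle a) (ℓ : Level) (n : ℕ) →
    let open Theory em ℓ n in
    (X : MeasurableSpace) → GeneratedBySingletons X →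
    UniversalModelTypeSpace X ×
    ((𝒰 : UniversalModelTypeSpace X) →
    IsUniversal (UniversalModelTypeSpace.typeSpace 𝒰))
theorem9 em ℓ n X generated =
  Singletons.universalModelTypeSpace em ℓ n X generated , universal em ℓ n X generated
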